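{- The generating function of the total sizes $h(s)$ of all $(s,s+1,s+2)$-core partitions is $$H(x)=\sum_{s\ge 0}h(s)x^s=\frac{x^2}{(1-2x-3x^2)^{5/2}}.$$
   Context: A partition is an $(s,s+1,s+2)$-core if no hook length of a box of its Young diagram is divisible by $s$, $s+1$ or $s+2$. $h(s)$ is the sum of the sizes of all $(s,s+1,s+2)$-core partitions (with $h(0)=h(1)=0$, the only such partition for $s\le 1$ being the empty one). -}

module Defs where

open import Data.Fin using (Fin; toℕ)
open import Data.Integer using (+_)
open import Data.List using (List; length; lookup; map; filter; drop)
open import Data.List.Membership.Propositional using (_∈_)
open import Data.List.Relation.Unary.All using (All)
open import Data.List.Relation.Unary.Linked using (Linked)
open import Data.List.Relation.Unary.Unique.Propositional using (Unique)
open import Data.Nat using (ℕ; zero; suc; _∸_; _≥_; _>_; _<?_)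
open import Data.Nat.Divisibility using (_∤_)
open import Data.Nat.ListAction using (sum)
open import Data.Product using (_×_)
open import Data.Rational using (ℚ; 0ℚ; 1ℚ; _+_; _*_; _-_; _/_)
open import Data.Rational.Properties using (+-*-commutativeRing)
open import Function using (_⇔_)
open import Relation.Binary.PropositionalEquality using (_≡_; cong)
open import Algebra.Bundles using (module CommutativeRing)
open import Algebra.Properties.Semiring.Sum (CommutativeRing.semiring +-*-commutativeRing) using (sum⁺-syntax)

IsPartition : List ℕ → Set
IsPartition μ = Linked _≥_ μ × All (_> 0) μ

-- A box of the Young diagram of μ is a row i : Fin (length μ) together with a
-- column j : Fin (lookup μ i); both coordinates start at 0.

arm : (μ : List ℕ) (i : Fin (length μ)) → Fin (lookup μ i) → ℕ
arm μ i j = lookup μ i ∸ suc (toℕ j)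

-- The rows below row i that are long enough to meet column j.
leg : (μ : List ℕ) (i : Fin (length μ)) → Fin (lookup μ i) → ℕ
leg μ i j = length (filter (toℕ j <?_) (drop (suc (toℕ i)) μ))

hook : (μ : List ℕ) (i : Fin (length μ)) → Fin (lookup μ i) → ℕ
hook μ i j = suc (arm μ i j Data.Nat.+ leg μ i j)

IsCore : ℕ → List ℕ → Set
IsCore t μ = ∀ i j → t ∤ hook μ i j

-- Hook lengths are positive, so every partition is a 0-core, while only the
-- empty partition is a 1-core; hence s = 0 and s = 1 need no special treatment.
IsTripleCorePartition : ℕ → List ℕ → Set
IsTripleCorePartition s μ =
  IsPartition μ × IsCore s μ × IsCore (suc s) μ × IsCore (suc (suc s)) μ

record CoreEnumeration (s : ℕ) : Set where
  field
    cores    : List (List ℕ)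
    unique   : Unique cores
    complete : ∀ μ → μ ∈ cores ⇔ IsTripleCorePartition s μ

-- Independent of the enumeration, since any two are permutations of each other.
totalSize : ∀ {s} → CoreEnumeration s → ℕ
totalSize e = sum (map sum (CoreEnumeration.cores e))

Series : Set
Series = ℕ → ℚ

infix 4 _≈ₛ_
_≈ₛ_ : Series → Series → Set
f ≈ₛ g = ∀ n → f n ≡ g n

generatingFunction : (ℕ → ℕ) → Series
generatingFunction a n = + a n / 1

const : ℚ → Series
const c zero    = c
const c (suc _) = 0ℚ

X : Series
X 1 = 1ℚ
X _ = 0ℚ

infixl 6 _-ₛ_
infixl 7 _*ₛ_
infixr 8 _^ₛ_

_-ₛ_ : Series → Series → Series
(f -ₛ g) n = f n - g n

_*ₛ_ : Series → Series → Series
(f *ₛ g) n = ∑[ k ≤ n ] (f (toℕ k) * g (n ∸ toℕ k))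

_^ₛ_ : Series → ℕ → Series
f ^ₛ zero  = const 1ℚ
f ^ₛ suc k = f *ₛ f ^ₛ k

-- f(u) = Σₖ fₖ uᵏ.  As u has no constant term, uᵏ contributes to the
-- coefficient of xⁿ only when k ≤ n.
substitute : Series → (u : Series) → .(u 0 ≡ 0ℚ) → Series
substitute f u _ n = ∑[ k ≤ n ] (f (toℕ k) * (u ^ₛ toℕ k) n)

-- α (α - 1) ⋯ (α - k + 1) / k!
binomial : ℚ → ℕ → ℚ
binomial α zero    = 1ℚ
binomial α (suc k) = binomial α k * (α - + k / 1) * (+ 1 / suc k)

-- f^α = Σₖ binomial α k · (f - 1)ᵏ
power : (f : Series) → .(f 0 ≡ 1ℚ) → ℚ → Series
power f f₀≡1 α = substitute (binomial α) (f -ₛ const 1ℚ) (cong (_- 1ℚ) f₀≡1)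

-- 1 / f = Σₖ (1 - f)ᵏ
inverse : (f : Series) → .(f 0 ≡ 1ℚ) → Series
inverse f f₀≡1 = substitute (λ _ → 1ℚ) (const 1ℚ -ₛ f) (cong (λ c → 1ℚ - c) f₀≡1)

divide : Series → (g : Series) → .(g 0 ≡ 1ℚ) → Series
divide f g g₀≡1 = f *ₛ inverse g g₀≡1

-- 1 - 2x - 3x²
quadratic : Series
quadratic = const 1ℚ -ₛ const (+ 2 / 1) *ₛ X -ₛ const (+ 3 / 1) *ₛ X ^ₛ 2

{-# OPTIONS --safe #-}
-- The first-column hook lengths of an (s,s+1,s+2)-core form a set of positive integers closed under subtraction
-- of s, s+1 and s+2.  Arranged on an abacus with s+1 runners, such a set is given by the numbers h_c of beads on
-- the runners c, and the closure conditions say that h is a Motzkin path of length s from 0 to 0.  The size of the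
-- core is
--   (s+2) ∑_c C(h_c,2) + ∑_{c ≤ c′} (1 - h_c) h_c′.
-- Summed over the paths that start at height k, each of the statistics involved satisfies
--   Z_k = x (Z_{k-1} + Z_k + Z_{k+1}) + (known source).
-- If y = x (1 + y + y²), this is solved by y^k times a polynomial in k whose coefficients are rational in y.
-- At k = 0 the solutions combine to x² V⁵ with V = (1 + y + y²)/(1 - y²), and V² (1 - 2x - 3x²) = 1.
-- Finally P = (1 - 2x - 3x²)^{5/2}, defined by the binomial series, satisfies a first-order differential equation
-- which makes P V⁵ constant.
module Submission where

-- The size of a core is not a sum of contributions of single heights: it involves the path length s
-- as a factor and the square of the total height. The factor s + 2 becomes the operator 2 + x d/dx
-- on generating series. The square, spread over pairs c ≤ c′, is an accumulation of an
-- accumulation, so the closed form of the inner statistic is the source of the outer equation. The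
-- equation for Z_k has the homogeneous solutions y^k and y^(-k); a source y^k times a polynomial in
-- k is therefore resonant and raises the degree by one, up to 4 for the cross sum. The factor 1 + k
-- of the polynomials expresses that there is no height -1. Since x multiplies the neighbouring
-- terms, the equation has exactly one solution, so a proposed closed form only has to be
-- substituted. This leaves polynomial identities modulo two relations, y = x M with M = 1 + y + y²
-- and U (1 - y²) = 1. The power 5/2 is never expanded: it enters through its differential equation
-- and its constant term alone.

open import Defs

-- Polynomial identities modulo the relations for y and U

module RingIdentities where

  open import Algebra.Bundles using (CommutativeRing)
  import Algebra.Solver.Ring as RingSolver
  open import Algebra.Solver.Ring.AlmostCommutativeRing using (fromCommutativeRing; _-Raw-AlmostCommutative⟶_)
  open import Data.Integer as ℤ using (+_)
  import Data.Integer.Properties as ℤₚ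
  open import Data.Maybe using (Maybe; just; nothing)
  open import Data.Nat using (ℕ; zero; suc)
  open import Level using (_⊔_)
  import Relation.Binary.PropositionalEquality as ≡
  open import Relation.Nullary using (yes; no)

  IntegerMorphism : ∀ {c ℓ} → CommutativeRing c ℓ → Set (c ⊔ ℓ)
  IntegerMorphism R =
    CommutativeRing.rawRing ℤₚ.+-*-commutativeRing -Raw-AlmostCommutative⟶ fromCommutativeRing R

  module IntegerSolver {c ℓ} (R : CommutativeRing c ℓ) (fromℤ : IntegerMorphism R) where

    open CommutativeRing R using (_≈_; refl)
    open _-Raw-AlmostCommutative⟶_ fromℤ using (⟦_⟧)

    coefficient≟ : ∀ a b → Maybe (⟦ a ⟧ ≈ ⟦ b ⟧)
    coefficient≟ a b with a ℤ.≟ b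
    ... | yes ≡.refl = just refl
    ... | no _       = nothing

    open RingSolver (CommutativeRing.rawRing ℤₚ.+-*-commutativeRing) (fromCommutativeRing R) fromℤ coefficient≟ public

  module MotzkinAlgebra {c ℓ} (R : CommutativeRing c ℓ)
    (fromℤ : IntegerMorphism R) where

    open CommutativeRing R
    open import Algebra.Properties.Semiring.Exp semiring using (_^_)
    open import Relation.Binary.Reasoning.Setoid setoid
    open _-Raw-AlmostCommutative⟶_ fromℤ using () renaming (⟦_⟧ to #)

    open IntegerSolver R fromℤ

    -- In the applications below c is the quotient of a - b by the relation e, found by polynomial division.
    infixl 2 _modulo_

    _modulo_ : ∀ {a b c e} → a ≈ b + c * e → e ≈ # (+ 0) → a ≈ b
    _modulo_ {a} {b} {c} {e} p e≈0 = begin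
      a              ≈⟨ p ⟩
      b + c * e      ≈⟨ +-congˡ (*-congˡ e≈0) ⟩
      b + c * # (+ 0) ≈⟨ solve 2 (λ b c → b :+ c :* con (+ 0) := b) refl b c ⟩
      b              ∎

    difference : ∀ {a b} → a ≈ b → a - b ≈ # (+ 0)
    difference {a} {b} a≈b = trans (+-congʳ a≈b) (solve 1 (λ b → b :- b := con (+ 0)) refl b)

    -- Built by adding one, so that `κ (suc n)` is literally the `I :+ k` of the solver goals, with
    -- `κ n` as the indeterminate k.
    κ : ℕ → Carrier
    κ zero    = # (+ 0)
    κ (suc n) = # (+ 1) + κ n

    module Parametrised (x y U : Carrier)
      (y≈ : y ≈ x * (# (+ 1) + y + y * y)) (U≈ : U * (# (+ 1) - y * y) ≈ # (+ 1)) where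

      M : Carrier
      M = # (+ 1) + y + y * y

      -- For Z_k = y^k p_k and S_k = y^k s_k the equation Z_k = x (Z_{k-1} + Z_k + Z_{k+1}) + S_k
      -- becomes (1 + y²) p_k = p_{k-1} + y² p_{k+1} + M s_k, because x M = y.

      transfer-zero : ∀ p₀ p₁ s → (# (+ 1) + y * y) * p₀ ≈ y * y * p₁ + M * s →
        p₀ ≈ x * (p₀ + y * p₁) + s
      transfer-zero p₀ p₁ s eq =
        solve 5 (λ x y p₀ p₁ s →
            let I = con (+ 1) ; M = I :+ y :+ y :* y in
            p₀ := x :* (p₀ :+ y :* p₁) :+ s
                  :+ (I :- x :- x :* y) :* ((I :+ y :* y) :* p₀ :- (y :* y :* p₁ :+ M :* s))
                  :+ (p₀ :+ y :* p₁ :- (I :+ y) :* (p₀ :- s)) :* (y :- x :* M))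
          refl x y p₀ p₁ s
        modulo difference y≈ modulo difference eq

      -- `T` stands for y^k. As an indeterminate it makes the equations at all positive heights one
      -- and the same polynomial identity.
      transfer-suc : ∀ T p₀ p₁ p₂ s → (# (+ 1) + y * y) * p₁ ≈ p₀ + y * y * p₂ + M * s →
        y * T * p₁ ≈ x * (T * p₀ + y * T * p₁ + y * (y * T) * p₂) + y * T * s
      transfer-suc T p₀ p₁ p₂ s eq =
        solve 7 (λ x y T p₀ p₁ p₂ s →
            let I = con (+ 1) ; M = I :+ y :+ y :* y in
            y :* T :* p₁ := x :* (T :* p₀ :+ y :* T :* p₁ :+ y :* (y :* T) :* p₂) :+ y :* T :* s
                  :+ x :* T :* ((I :+ y :* y) :* p₁ :- (p₀ :+ y :* y :* p₂ :+ M :* s))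
                  :+ T :* (p₁ :- s) :* (y :- x :* M))
          refl x y T p₀ p₁ p₂ s
        modulo difference y≈ modulo difference eq

      -- The polynomials p in k with p(-1) = 0 for which (1 + y²) p(k) - p(k-1) - y² p(k+1) equals
      -- 2 k, 3 k (k - 1) and 12 (1 - k) areaPoly(k) respectively.
      areaPoly binomialPoly crossPoly : Carrier → Carrier
      areaPoly k = (# (+ 1) + k) * (U * k + # (+ 2) * (U * y) ^ 2)
      binomialPoly k = (# (+ 1) + k) *
        (U * k ^ 2 + (# (+ 4) * y ^ 2 - # (+ 1)) * U ^ 2 * k + # (+ 6) * y ^ 4 * U ^ 3)
      crossPoly k = (# (+ 1) + k) *
        (- (# (+ 3) * U ^ 2 * k ^ 3) - (# (+ 3) + # (+ 17) * y ^ 2) * U ^ 3 * k ^ 2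
        + (# (+ 6) - # (+ 40) * y ^ 2 - # (+ 26) * y ^ 4) * U ^ 4 * k
        + # (+ 24) * (y ^ 2 - # (+ 6) * y ^ 4) * U ^ 5)

      private
        :area :binomial :cross : ∀ {n} → Polynomial n → Polynomial n → Polynomial n → Polynomial n
        :area y U k = (con (+ 1) :+ k) :* (U :* k :+ con (+ 2) :* (U :* y) :^ 2)
        :binomial y U k = (con (+ 1) :+ k) :*
          (U :* k :^ 2 :+ (con (+ 4) :* y :^ 2 :- con (+ 1)) :* U :^ 2 :* k :+ con (+ 6) :* y :^ 4 :* U :^ 3)
        :cross y U k = (con (+ 1) :+ k) :*
          (:- (con (+ 3) :* U :^ 2 :* k :^ 3) :- (con (+ 3) :+ con (+ 17) :* y :^ 2) :* U :^ 3 :* k :^ 2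
          :+ (con (+ 6) :- con (+ 40) :* y :^ 2 :- con (+ 26) :* y :^ 4) :* U :^ 4 :* k
          :+ con (+ 24) :* (y :^ 2 :- con (+ 6) :* y :^ 4) :* U :^ 5)

        :relation : ∀ {n} → Polynomial n → Polynomial n → Polynomial n
        :relation y U = U :* (con (+ 1) :- y :* y) :- con (+ 1)

      -- Sources are written as coefficient times inner closed form, the shape that
      -- `pathSum-accumulate` expects. Here the inner statistic is `one`, with closed form 1; in
      -- `crossPoly-zero` it is `doubleArea`, with closed form `areaPoly`.
      areaPoly-zero : (# (+ 1) + y * y) * areaPoly (κ 0) ≈ y * y * areaPoly (κ 1) + # (+ 2) * κ 0 * # (+ 1)
      areaPoly-zero =
        solve 2 (λ y U → let O = con (+ 0) ; I = con (+ 1) in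
          (I :+ y :* y) :* :area y U O :=
            y :* y :* :area y U (I :+ O) :+ con (+ 2) :* O :* I :+ con (+ 2) :* y :^ 2 :* U :* :relation y U)
          refl y U
        modulo difference U≈

      areaPoly-suc : ∀ n → (# (+ 1) + y * y) * areaPoly (κ (suc n)) ≈
        areaPoly (κ n) + y * y * areaPoly (κ (suc (suc n))) + # (+ 2) * κ (suc n) * # (+ 1)
      areaPoly-suc n =
        solve 3 (λ y U k → let I = con (+ 1) in
          (I :+ y :* y) :* :area y U (I :+ k) :=
            :area y U k :+ y :* y :* :area y U (I :+ (I :+ k)) :+ con (+ 2) :* (I :+ k) :* I
            :+ con (+ 2) :* (I :+ k :+ y :^ 2 :* U) :* :relation y U)
          refl y U (κ n)
        modulo difference U≈

      binomialPoly-zero : (# (+ 1) + y * y) * binomialPoly (κ 0) ≈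
        y * y * binomialPoly (κ 1) + # (+ 3) * (κ 0 * (κ 0 - # (+ 1))) * # (+ 1)
      binomialPoly-zero =
        solve 2 (λ y U → let O = con (+ 0) ; I = con (+ 1) in
          (I :+ y :* y) :* :binomial y U O :=
            y :* y :* :binomial y U (I :+ O) :+ con (+ 3) :* (O :* (O :- I)) :* I
            :+ (con (+ 2) :* y :^ 2 :* U :+ con (+ 6) :* y :^ 4 :* U :^ 2) :* :relation y U)
          refl y U
        modulo difference U≈

      binomialPoly-suc : ∀ n → (# (+ 1) + y * y) * binomialPoly (κ (suc n)) ≈
        binomialPoly (κ n) + y * y * binomialPoly (κ (suc (suc n))) + # (+ 3) * (κ (suc n) * (κ (suc n) - # (+ 1))) * # (+ 1)
      binomialPoly-suc n =
        solve 3 (λ y U k → let I = con (+ 1) in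
          (I :+ y :* y) :* :binomial y U (I :+ k) :=
            :binomial y U k :+ y :* y :* :binomial y U (I :+ (I :+ k)) :+ con (+ 3) :* ((I :+ k) :* (I :+ k :- I)) :* I
            :+ (con (+ 3) :* k :* (I :+ k)
               :+ (con (+ 8) :* k :* y :^ 2 :+ con (+ 10) :* y :^ 2 :- con (+ 2) :* (I :+ k)) :* U
               :+ con (+ 6) :* y :^ 4 :* U :^ 2) :* :relation y U)
          refl y U (κ n)
        modulo difference U≈

      crossPoly-zero : (# (+ 1) + y * y) * crossPoly (κ 0) ≈
        y * y * crossPoly (κ 1) + # (+ 12) * (# (+ 1) - κ 0) * areaPoly (κ 0)
      crossPoly-zero =
        solve 2 (λ y U → let O = con (+ 0) ; I = con (+ 1) in
          (I :+ y :* y) :* :cross y U O :=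
            y :* y :* :cross y U (I :+ O) :+ con (+ 12) :* (I :- O) :* :area y U O
            :+ (con (+ 18) :* y :^ 2 :* U :^ 2
               :+ (con (+ 12) :* y :^ 2 :- con (+ 52) :* y :^ 4) :* U :^ 3
               :+ (con (+ 24) :* y :^ 2 :- con (+ 144) :* y :^ 4) :* U :^ 4) :* :relation y U)
          refl y U
        modulo difference U≈

      crossPoly-suc : ∀ n → (# (+ 1) + y * y) * crossPoly (κ (suc n)) ≈
        crossPoly (κ n) + y * y * crossPoly (κ (suc (suc n))) + # (+ 12) * (# (+ 1) - κ (suc n)) * areaPoly (κ (suc n))
      crossPoly-suc n =
        solve 3 (λ y U k → let I = con (+ 1) in
          (I :+ y :* y) :* :cross y U (I :+ k) :=
            :cross y U k :+ y :* y :* :cross y U (I :+ (I :+ k)) :+ con (+ 12) :* (I :- (I :+ k)) :* :area y U (I :+ k)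
            :+ (:- (con (+ 24) :* k :+ con (+ 36) :* k :^ 2 :+ con (+ 12) :* k :^ 3) :* U
               :+ (con (+ 6) :- con (+ 66) :* y :^ 2 :- con (+ 3) :* k :- con (+ 135) :* k :* y :^ 2
                  :- con (+ 9) :* k :^ 2 :- con (+ 51) :* k :^ 2 :* y :^ 2) :* U :^ 2
               :+ (con (+ 12) :- con (+ 68) :* y :^ 2 :- con (+ 104) :* y :^ 4 :+ con (+ 12) :* k
                  :- con (+ 80) :* k :* y :^ 2 :- con (+ 52) :* k :* y :^ 4) :* U :^ 3
               :+ (con (+ 24) :* y :^ 2 :- con (+ 144) :* y :^ 4) :* U :^ 4) :* :relation y U)
          refl y U (κ n)
        modulo difference U≈

      -- The square of x is spelled as `X ^ₛ 2` unfolds, so that `D` is `quadratic` itself once x is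
      -- `X`.
      V D : Carrier
      V = M * U
      D = # (+ 1) - # (+ 2) * x - # (+ 3) * (x * (x * # (+ 1)))

      -- Because x = y / M, the product M² D equals M² - 2 y M - 3 y² = (M - 3 y)(M + y) = (1 - y)²
      -- (1 + y)².
      V²D≈1 : V * V * D ≈ # (+ 1)
      V²D≈1 =
        solve 3 (λ x y U →
            let I = con (+ 1) ; M = I :+ y :+ y :* y ; V = M :* U ; e = y :- x :* M in
            V :* V :* (I :- con (+ 2) :* x :- con (+ 3) :* (x :* (x :* I))) :=
              I :+ (con (+ 2) :+ :relation y U) :* :relation y U
              :+ U :^ 2 :* (con (+ 2) :* M :+ con (+ 6) :* y :- con (+ 3) :* e) :* e)
          refl x y U
        modulo difference y≈ modulo difference U≈

      module Derivation (θ : Carrier → Carrier)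
        (θ-cong : ∀ {a b} → a ≈ b → θ a ≈ θ b)
        (θ-+ : ∀ a b → θ (a + b) ≈ θ a + θ b)
        (θ-neg : ∀ a → θ (- a) ≈ - θ a)
        (θ-* : ∀ a b → θ (a * b) ≈ θ a * b + a * θ b)
        (θ-# : ∀ z → θ (# z) ≈ # (+ 0))
        (θx : θ x ≈ x) where

        private
          infixl 6 _⊕_
          infixl 7 _⊗_

          _⊕_ : ∀ {a b a′ b′} → θ a ≈ a′ → θ b ≈ b′ → θ (a + b) ≈ a′ + b′
          p ⊕ q = trans (θ-+ _ _) (+-cong p q)

          _⊗_ : ∀ {a b a′ b′} → θ a ≈ a′ → θ b ≈ b′ → θ (a * b) ≈ a′ * b + a * b′
          p ⊗ q = trans (θ-* _ _) (+-cong (*-congʳ p) (*-congˡ q))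

          ⊖_ : ∀ {a a′} → θ a ≈ a′ → θ (- a) ≈ - a′
          ⊖ p = trans (θ-neg _) (-‿cong p)

        -- Implicit differentiation of y = x M gives (1 - x (1 + 2 y)) θy = y, and M (1 - x (1 + 2
        -- y)) = 1 - y².
        θy : θ y ≈ y * M * U
        θy =
          solve 4 (λ x y U d →
              let I = con (+ 1) ; M = I :+ y :+ y :* y in
              d := y :* M :* U
                :+ U :* M :* (d :- (x :* M :+ x :* (con (+ 0) :+ d :+ (d :* y :+ y :* d))))
                :+ (:- (U :* M :+ U :* (I :+ con (+ 2) :* y) :* d)) :* (y :- x :* M)
                :+ (:- d) :* :relation y U)
            refl x y U (θ y)
          modulo difference U≈ modulo difference y≈
          modulo difference (trans (θ-cong y≈) (θx ⊗ (θ-# (+ 1) ⊕ refl ⊕ refl ⊗ refl)))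

        θU : θ U ≈ # (+ 2) * y ^ 2 * M * U ^ 3
        θU =
          solve 3 (λ y U d →
              let I = con (+ 1) ; O = con (+ 0) ; M = I :+ y :+ y :* y ; y′ = y :* M :* U in
              d := con (+ 2) :* y :^ 2 :* M :* U :^ 3
                :+ U :* ((d :* (I :- y :* y) :+ U :* (O :- (y′ :* y :+ y :* y′))) :- O)
                :+ (:- d) :* :relation y U)
            refl y U (θ U)
          modulo difference U≈
          modulo difference (trans (sym (refl ⊗ (θ-# (+ 1) ⊕ ⊖ (θy ⊗ θy)))) (trans (θ-cong U≈) (θ-# (+ 1))))

        -- The size formula at k = 0, multiplied by 24 = 4 · 6: the weight s + 2 of the binomial sum
        -- has become 2 + θ. The left side reduces to 24 y² M³ U⁵, and trading y² for x² M²
        -- completes V⁵.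
        size-closed :
          # (+ 4) * (# (+ 2) * (M * M * binomialPoly (κ 0)) + θ (M * M * binomialPoly (κ 0)))
            + M * (M * M) * crossPoly (κ 0)
          ≈ # (+ 24) * (x * x * V ^ 5)
        size-closed = begin
          # (+ 4) * (# (+ 2) * b + θ b) + M * (M * M) * crossPoly (κ 0)
            ≈⟨ +-congʳ (*-congˡ (+-congˡ (trans (θ-cong b≈) θb))) ⟩
          # (+ 4) * (# (+ 2) * b + b′) + M * (M * M) * crossPoly (κ 0)
            ≈⟨ (solve 2 (λ y U →
                 let I = con (+ 1) ; O = con (+ 0) ; M = I :+ y :+ y :* y ; y′ = y :* M :* U
                     U′ = con (+ 2) :* y :^ 2 :* M :* U :^ 3
                     N = M :* (y :* y) :* U
                     N′ = ((O :+ y′ :+ (y′ :* y :+ y :* y′)) :* (y :* y) :+ M :* (y′ :* y :+ y :* y′)) :* U :+ M :* (y :* y) :* U′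
                 in
                 con (+ 4) :* (con (+ 2) :* (M :* M :* :binomial y U O)
                     :+ (O :* (N :* N :* U) :+ con (+ 6) :* ((N′ :* N :+ N :* N′) :* U :+ N :* N :* U′)))
                   :+ M :* (M :* M) :* :cross y U O
                 := con (+ 24) :* (y :* y :* M :^ 3 :* U :^ 5)
                   :+ (:- (con (+ 24) :* M :^ 2 :* y :^ 4 :* U :^ 3 :* (con (+ 2) :+ con (+ 6) :* M :* U))) :* :relation y U)
                 refl y U modulo difference U≈) ⟩
          # (+ 24) * (y * y * M ^ 3 * U ^ 5)
            ≈⟨ *-congˡ (*-congʳ (*-congʳ (*-cong y≈ y≈))) ⟩
          # (+ 24) * (x * M * (x * M) * M ^ 3 * U ^ 5)
            ≈⟨ solve 3 (λ x M U → con (+ 24) :* (x :* M :* (x :* M) :* M :^ 3 :* U :^ 5) := con (+ 24) :* (x :* x :* (M :* U) :^ 5))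
                 refl x M U ⟩
          # (+ 24) * (x * x * V ^ 5) ∎
          where
          b N : Carrier
          b = M * M * binomialPoly (κ 0)
          N = M * (y * y) * U
          -- At k = 0 only 6 y⁴ U³ survives in `binomialPoly`. Writing its powers as products makes
          -- the Leibniz rule `_⊗_` applicable.
          b≈ : b ≈ # (+ 6) * (N * N * U)
          b≈ = solve 3 (λ M y U → M :* M :* :binomial y U (con (+ 0)) :=
                 con (+ 6) :* (M :* (y :* y) :* U :* (M :* (y :* y) :* U) :* U)) refl M y U
          θN = (θ-# (+ 1) ⊕ θy ⊕ θy ⊗ θy) ⊗ (θy ⊗ θy) ⊗ θU
          θb = θ-# (+ 6) ⊗ (θN ⊗ θN ⊗ θU)
          b′ : Carrier
          b′ = _

        -- Logarithmic derivatives: θP / P = α θD / D, while V² D = 1 gives θV / V = - θD / (2 D),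
        -- so those of P and V⁵ cancel when α = 5/2. Division is avoided by multiplying with V² D.
        power-V⁵ : ∀ P α → # (+ 2) * α ≈ # (+ 5) → D * θ P ≈ α * θ D * P → θ (P * V ^ 5) ≈ # (+ 0)
        power-V⁵ P α 2α≈5 ode = begin
          θ (P * V ^ 5)
            ≈⟨ θ-cong (solve 2 (λ P V → P :* V :^ 5 := P :* (V :* V :* (V :* V) :* V)) refl P V) ⟩
          θ (P * (V * V * (V * V) * V))
            ≈⟨ refl ⊗ (refl ⊗ refl ⊗ (refl ⊗ refl) ⊗ refl) ⟩
          _
            ≈⟨ (solve 7 (λ P V D p v d α →
                 let v² = v :* V :+ V :* v ; W = V :* V :* (V :* V) :* V
                     l = p :* W :+ P :* ((v² :* (V :* V) :+ V :* V :* v²) :* V :+ V :* V :* (V :* V) :* v)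
                 in l := con (+ 0) :+ V :^ 7 :* (D :* p :- α :* d :* P)
                       :+ α :* P :* V :^ 5 :* (v² :* D :+ V :* V :* d :- con (+ 0))
                       :+ (:- (P :* V :^ 6 :* D :* v)) :* (con (+ 2) :* α :- con (+ 5))
                       :+ (:- l) :* (V :* V :* D :- con (+ 1)))
                 refl P V D (θ P) (θ V) (θ D) α
               modulo difference V²D≈1 modulo difference 2α≈5
               modulo difference (trans (sym (refl ⊗ refl ⊗ refl)) (trans (θ-cong V²D≈1) (θ-# (+ 1))))
               modulo difference ode) ⟩
          # (+ 0) ∎

open RingIdentities

-- Formal power series: ring laws, x d/dx, substitution, inverses and powers

module FormalSeries where

  open import Algebra.Bundles using (CommutativeRing)
  open import Data.Fin using (toℕ)
  open import Data.Integer as ℤ using (ℤ; +_)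
  import Data.Integer.Properties as ℤₚ
  import Data.Nat.Coprimality as Coprimality
  open import Data.Nat using (ℕ; zero; suc; z≤n; s≤s; _≤_; _<_)
  import Data.Nat.Properties as ℕₚ
  open import Data.Product using (_,_)
  open import Data.Rational using (ℚ; mkℚ; 0ℚ; 1ℚ; _+_; _*_; _-_; -_; _/_)
  import Data.Rational.Properties as ℚₚ
  open import Data.Rational.Solver using (module +-*-Solver)
  open import Level using (0ℓ)
  open import Relation.Binary.PropositionalEquality using (_≡_; refl; sym; trans; cong; cong₂; module ≡-Reasoning)
  open import Algebra.Properties.Semiring.Sum (CommutativeRing.semiring ℚₚ.+-*-commutativeRing)
    using (sum-syntax; sum-cong-≗; ∑-distrib-+; *-distribˡ-sum; sum-replicate-zero)
  import Relation.Binary.Reasoning.Setoid as SetoidReasoning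

  infixl 6 _+ₛ_
  infix 8 -ₛ_

  _+ₛ_ : Series → Series → Series
  (f +ₛ g) n = f n + g n

  -ₛ_ : Series → Series
  (-ₛ f) n = - f n

  0ₛ 1ₛ : Series
  0ₛ = const 0ℚ
  1ₛ = const 1ℚ

  tail : Series → Series
  tail f n = f (suc n)

  0ₛ≡0 : ∀ n → 0ₛ n ≡ 0ℚ
  0ₛ≡0 zero    = refl
  0ₛ≡0 (suc n) = refl

  -- The definition of the product unfolds to
  --   (f g)₀ = f₀ g₀  and  tail (f g) = f₀ (tail g) + (tail f) g,
  -- which turns every ring law into an induction on the coefficient.

  *ₛ-cong : ∀ {f f′ g g′} → f ≈ₛ f′ → g ≈ₛ g′ → f *ₛ g ≈ₛ f′ *ₛ g′
  *ₛ-cong p q zero    = cong₂ (λ a b → a * b + 0ℚ) (p 0) (q 0)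
  *ₛ-cong p q (suc n) =
    cong₂ _+_ (cong₂ _*_ (p 0) (q (suc n))) (*ₛ-cong (λ k → p (suc k)) q n)

  scale-*ₛ : ∀ c f g n → ((λ k → c * f k) *ₛ g) n ≡ c * (f *ₛ g) n
  scale-*ₛ c f g zero    =
    solve 3 (λ c a b → c :* a :* b :+ con 0ℚ := c :* (a :* b :+ con 0ℚ)) refl c (f 0) (g 0)
    where open +-*-Solver
  scale-*ₛ c f g (suc n) = trans
    (cong (λ r → c * f 0 * g (suc n) + r) (scale-*ₛ c (tail f) g n))
    (solve 4 (λ c a b d → c :* a :* b :+ c :* d := c :* (a :* b :+ d)) refl
      c (f 0) (g (suc n)) ((tail f *ₛ g) n))
    where open +-*-Solver

  *ₛ-distribʳ : ∀ h f g → (f +ₛ g) *ₛ h ≈ₛ f *ₛ h +ₛ g *ₛ h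
  *ₛ-distribʳ h f g zero    =
    solve 3 (λ a b c → (a :+ b) :* c :+ con 0ℚ := a :* c :+ con 0ℚ :+ (b :* c :+ con 0ℚ)) refl
      (f 0) (g 0) (h 0)
    where open +-*-Solver
  *ₛ-distribʳ h f g (suc n) = trans
    (cong (λ r → (f 0 + g 0) * h (suc n) + r) (*ₛ-distribʳ h (tail f) (tail g) n))
    (solve 5 (λ a b c d e → (a :+ b) :* c :+ (d :+ e) := a :* c :+ d :+ (b :* c :+ e)) refl
      (f 0) (g 0) (h (suc n)) ((tail f *ₛ h) n) ((tail g *ₛ h) n))
    where open +-*-Solver

  -- The definition peels off the constant term of the left factor; commutativity also needs that of
  -- the right factor.
  *ₛ-suc : ∀ f g n → (f *ₛ g) (suc n) ≡ f (suc n) * g 0 + (f *ₛ tail g) n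
  *ₛ-suc f g zero    =
    solve 4 (λ a b c d → a :* b :+ (c :* d :+ con 0ℚ) := c :* d :+ (a :* b :+ con 0ℚ)) refl
      (f 0) (g 1) (f 1) (g 0)
    where open +-*-Solver
  *ₛ-suc f g (suc n) = trans
    (cong (λ r → f 0 * g (suc (suc n)) + r) (*ₛ-suc (tail f) g n))
    (solve 3 (λ a b c → a :+ (b :+ c) := b :+ (a :+ c)) refl
      (f 0 * g (suc (suc n))) (f (suc (suc n)) * g 0) ((tail f *ₛ tail g) n))
    where open +-*-Solver

  *ₛ-comm : ∀ f g → f *ₛ g ≈ₛ g *ₛ f
  *ₛ-comm f g zero    = cong (_+ 0ℚ) (ℚₚ.*-comm (f 0) (g 0))
  *ₛ-comm f g (suc n) = trans
    (cong₂ _+_ (ℚₚ.*-comm (f 0) (g (suc n))) (*ₛ-comm (tail f) g n))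
    (sym (*ₛ-suc g f n))

  *ₛ-assoc : ∀ f g h → (f *ₛ g) *ₛ h ≈ₛ f *ₛ (g *ₛ h)
  *ₛ-assoc f g h zero    =
    solve 3 (λ a b c → (a :* b :+ con 0ℚ) :* c :+ con 0ℚ := a :* (b :* c :+ con 0ℚ) :+ con 0ℚ) refl
      (f 0) (g 0) (h 0)
    where open +-*-Solver
  *ₛ-assoc f g h (suc n) = begin
    (f 0 * g 0 + 0ℚ) * h (suc n) + (tail (f *ₛ g) *ₛ h) n
      ≡⟨ cong (λ r → (f 0 * g 0 + 0ℚ) * h (suc n) + r)
           (*ₛ-distribʳ h (λ k → f 0 * tail g k) (tail f *ₛ g) n) ⟩
    (f 0 * g 0 + 0ℚ) * h (suc n) + (((λ k → f 0 * tail g k) *ₛ h) n + ((tail f *ₛ g) *ₛ h) n)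
      ≡⟨ cong₂ (λ a b → (f 0 * g 0 + 0ℚ) * h (suc n) + (a + b))
           (scale-*ₛ (f 0) (tail g) h n) (*ₛ-assoc (tail f) g h n) ⟩
    (f 0 * g 0 + 0ℚ) * h (suc n) + (f 0 * (tail g *ₛ h) n + (tail f *ₛ (g *ₛ h)) n)
      ≡⟨ solve 5 (λ a b c d e → (a :* b :+ con 0ℚ) :* c :+ (a :* d :+ e) := a :* (b :* c :+ d) :+ e) refl
           (f 0) (g 0) (h (suc n)) ((tail g *ₛ h) n) ((tail f *ₛ (g *ₛ h)) n) ⟩
    f 0 * (g 0 * h (suc n) + (tail g *ₛ h) n) + (tail f *ₛ (g *ₛ h)) n ∎
    where open ≡-Reasoning
          open +-*-Solver

  0-*ₛ : ∀ {f} g → (∀ n → f n ≡ 0ℚ) → ∀ n → (f *ₛ g) n ≡ 0ℚ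
  0-*ₛ g f≡0 zero    = trans (ℚₚ.+-identityʳ _) (trans (cong (_* g 0) (f≡0 0)) (ℚₚ.*-zeroˡ (g 0)))
  0-*ₛ g f≡0 (suc n) = cong₂ _+_ (trans (cong (_* g (suc n)) (f≡0 0)) (ℚₚ.*-zeroˡ (g (suc n))))
                                 (0-*ₛ g (λ k → f≡0 (suc k)) n)

  const-*ₛ : ∀ c f n → (const c *ₛ f) n ≡ c * f n
  const-*ₛ c f zero    = ℚₚ.+-identityʳ _
  const-*ₛ c f (suc n) = trans (cong (λ r → c * f (suc n) + r) (0-*ₛ f (λ _ → refl) n)) (ℚₚ.+-identityʳ _)

  *ₛ-identityˡ : ∀ f → 1ₛ *ₛ f ≈ₛ f
  *ₛ-identityˡ f n = trans (const-*ₛ 1ℚ f n) (ℚₚ.*-identityˡ (f n))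

  seriesRing : CommutativeRing 0ℓ 0ℓ
  seriesRing = record
    { Carrier = Series
    ; _≈_ = _≈ₛ_
    ; _+_ = _+ₛ_
    ; _*_ = _*ₛ_
    ; -_ = -ₛ_
    ; 0# = 0ₛ
    ; 1# = 1ₛ
    ; isCommutativeRing = record
      { isRing = record
        { +-isAbelianGroup = record
          { isGroup = record
            { isMonoid = record
              { isSemigroup = record
                { isMagma = record
                  { isEquivalence = record
                    { refl  = λ _ → refl
                    ; sym   = λ p n → sym (p n)
                    ; trans = λ p q n → trans (p n) (q n)
                    }
                  ; ∙-cong = λ p q n → cong₂ _+_ (p n) (q n)
                  }
                ; assoc = λ f g h n → ℚₚ.+-assoc (f n) (g n) (h n)
                }
              ; identity = (λ f n → trans (cong (_+ f n) (0ₛ≡0 n)) (ℚₚ.+-identityˡ (f n)))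
                         , (λ f n → trans (cong (λ r → f n + r) (0ₛ≡0 n)) (ℚₚ.+-identityʳ (f n)))
              }
            ; inverse = (λ f n → trans (ℚₚ.+-inverseˡ (f n)) (sym (0ₛ≡0 n)))
                      , (λ f n → trans (ℚₚ.+-inverseʳ (f n)) (sym (0ₛ≡0 n)))
            ; ⁻¹-cong = λ p n → cong -_ (p n)
            }
          ; comm = λ f g n → ℚₚ.+-comm (f n) (g n)
          }
        ; *-cong = *ₛ-cong
        ; *-assoc = *ₛ-assoc
        ; *-identity = *ₛ-identityˡ , λ f n → trans (*ₛ-comm f 1ₛ n) (*ₛ-identityˡ f n)
        ; distrib = (λ f g h n → trans (*ₛ-comm f (g +ₛ h) n)
                      (trans (*ₛ-distribʳ f g h n) (cong₂ _+_ (*ₛ-comm g f n) (*ₛ-comm h f n))))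
                  , *ₛ-distribʳ
        }
      ; *-comm = *ₛ-comm
      }
    }

  -- The fraction `z / 1` passes through a gcd and is stuck on a variable z; this normal form
  -- computes.
  fromℤ : ℤ → ℚ
  fromℤ z = mkℚ z 0 (Coprimality.sym (Coprimality.1-coprimeTo _))

  /1≡fromℤ : ∀ z → z / 1 ≡ fromℤ z
  /1≡fromℤ z = ℚₚ.↥p/↧p≡p (fromℤ z)

  /1-+ : ∀ a b → (a ℤ.+ b) / 1 ≡ a / 1 + b / 1
  /1-+ a b = begin
    (a ℤ.+ b) / 1                    ≡⟨ cong (_/ 1) (cong₂ ℤ._+_ (ℤₚ.*-identityʳ a) (ℤₚ.*-identityʳ b)) ⟨
    (a ℤ.* + 1 ℤ.+ b ℤ.* + 1) / 1    ≡⟨⟩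
    fromℤ a + fromℤ b                ≡⟨ cong₂ _+_ (/1≡fromℤ a) (/1≡fromℤ b) ⟨
    a / 1 + b / 1                    ∎
    where open ≡-Reasoning

  /1-* : ∀ a b → (a ℤ.* b) / 1 ≡ a / 1 * (b / 1)
  /1-* a b = begin
    (a ℤ.* b) / 1      ≡⟨⟩
    fromℤ a * fromℤ b  ≡⟨ cong₂ _*_ (/1≡fromℤ a) (/1≡fromℤ b) ⟨
    a / 1 * (b / 1)    ∎
    where open ≡-Reasoning

  /1-neg : ∀ a → (ℤ.- a) / 1 ≡ - (a / 1)
  /1-neg a = trans (/1≡fromℤ (ℤ.- a)) (trans (neg a) (cong -_ (sym (/1≡fromℤ a))))
    where
    neg : ∀ a → fromℤ (ℤ.- a) ≡ - fromℤ a
    neg (+ zero)      = refl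
    neg (+ suc n)     = refl
    neg (ℤ.-[1+ n ])  = refl

  ι : ℕ → ℚ
  ι n = + n / 1

  ι-suc : ∀ n → ι (suc n) ≡ 1ℚ + ι n
  ι-suc n = /1-+ (+ 1) (+ n)

  ι-inverse : ∀ k → ι (suc k) * (+ 1 / suc k) ≡ 1ℚ
  ι-inverse k = trans (cong₂ _*_ (/1≡fromℤ (+ suc k)) (ℚₚ.↥p/↧p≡p (mkℚ (+ 1) k (Coprimality.1-coprimeTo _))))
    (ℚₚ.*-inverseʳ (fromℤ (+ suc k)))

  module R = CommutativeRing seriesRing

  fromℤ-morphism : IntegerMorphism seriesRing
  fromℤ-morphism = record
    { ⟦_⟧    = λ z → const (z / 1)
    ; +-homo = λ { a b zero → /1-+ a b ; a b (suc n) → refl }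
    ; *-homo = λ { a b n → trans (homo a b n) (sym (const-*ₛ (a / 1) (const (b / 1)) n)) }
    ; -‿homo = λ { a zero → /1-neg a ; a (suc n) → refl }
    ; 0-homo = λ _ → refl
    ; 1-homo = λ _ → refl
    }
    where
    homo : ∀ a b n → const ((a ℤ.* b) / 1) n ≡ a / 1 * const (b / 1) n
    homo a b zero    = /1-* a b
    homo a b (suc n) = sym (ℚₚ.*-zeroʳ (a / 1))

  module Solver = IntegerSolver seriesRing fromℤ-morphism

  module ≈-Reasoning = SetoidReasoning R.setoid

  -- The Euler operator x d/dx. Unlike d/dx it does not shift coefficients, so it is multiplication
  -- of the n-th one by n, as the weight s + 2 requires.
  θ : Series → Series
  θ f n = ι n * f n

  θ-cong : ∀ {f g} → f ≈ₛ g → θ f ≈ₛ θ g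
  θ-cong p n = cong (ι n *_) (p n)

  θ-+ : ∀ f g → θ (f +ₛ g) ≈ₛ θ f +ₛ θ g
  θ-+ f g n = ℚₚ.*-distribˡ-+ (ι n) (f n) (g n)

  θ-neg : ∀ f → θ (-ₛ f) ≈ₛ -ₛ θ f
  θ-neg f n = sym (ℚₚ.neg-distribʳ-* (ι n) (f n))

  θ-const : ∀ c → θ (const c) ≈ₛ 0ₛ
  θ-const c zero    = ℚₚ.*-zeroˡ c
  θ-const c (suc n) = ℚₚ.*-zeroʳ (ι (suc n))

  θ-* : ∀ f g → θ (f *ₛ g) ≈ₛ θ f *ₛ g +ₛ f *ₛ θ g
  θ-* f g zero    =
    solve 2 (λ a b → con 0ℚ :* (a :* b :+ con 0ℚ) := con 0ℚ :* a :* b :+ con 0ℚ :+ (a :* (con 0ℚ :* b) :+ con 0ℚ)) refl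
      (f 0) (g 0)
    where open +-*-Solver
  θ-* f g (suc n) = begin
    ι (suc n) * (f 0 * g (suc n) + (tail f *ₛ g) n)
      ≡⟨ cong (_* (f 0 * g (suc n) + (tail f *ₛ g) n)) (ι-suc n) ⟩
    (1ℚ + ι n) * (f 0 * g (suc n) + (tail f *ₛ g) n)
      ≡⟨ solve 4 (λ i a b c → (con 1ℚ :+ i) :* (a :* b :+ c) := a :* ((con 1ℚ :+ i) :* b) :+ (i :* c :+ c)) refl
           (ι n) (f 0) (g (suc n)) ((tail f *ₛ g) n) ⟩
    f 0 * ((1ℚ + ι n) * g (suc n)) + (ι n * (tail f *ₛ g) n + (tail f *ₛ g) n)
      ≡⟨ cong₂ (λ a b → f 0 * (a * g (suc n)) + (b + (tail f *ₛ g) n)) (sym (ι-suc n)) (θ-* (tail f) g n) ⟩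
    f 0 * θ g (suc n) + ((θ (tail f) *ₛ g) n + (tail f *ₛ θ g) n + (tail f *ₛ g) n)
      ≡⟨ solve 4 (λ a b c d → a :+ (b :+ c :+ d) := (d :+ b) :+ (a :+ c)) refl
           (f 0 * θ g (suc n)) ((θ (tail f) *ₛ g) n) ((tail f *ₛ θ g) n) ((tail f *ₛ g) n) ⟩
    ((tail f *ₛ g) n + (θ (tail f) *ₛ g) n) + (f 0 * θ g (suc n) + (tail f *ₛ θ g) n)
      ≡⟨ cong (_+ (f *ₛ θ g) (suc n)) (trans (sym (*ₛ-distribʳ g (tail f) (θ (tail f)) n)) (*ₛ-cong {g = g} tail-θ R.refl n)) ⟩
    (tail (θ f) *ₛ g) n + (f *ₛ θ g) (suc n)
      ≡⟨ cong (_+ (f *ₛ θ g) (suc n)) (trans (cong (_+ (tail (θ f) *ₛ g) n) θf₀) (ℚₚ.+-identityˡ ((tail (θ f) *ₛ g) n))) ⟨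
    (θ f *ₛ g) (suc n) + (f *ₛ θ g) (suc n) ∎
    where
    open ≡-Reasoning
    open +-*-Solver
    -- Passing to the tail lowers every index by one, hence the additional `tail f`.
    tail-θ : tail f +ₛ θ (tail f) ≈ₛ tail (θ f)
    tail-θ k = trans (solve 2 (λ i a → a :+ i :* a := (con 1ℚ :+ i) :* a) refl (ι k) (f (suc k)))
                     (cong (_* f (suc k)) (sym (ι-suc k)))
    θf₀ : θ f 0 * g (suc n) ≡ 0ℚ
    θf₀ = trans (cong (_* g (suc n)) (ℚₚ.*-zeroˡ (f 0))) (ℚₚ.*-zeroˡ (g (suc n)))

  -- Characteristic zero enters here: n + 1 is invertible in ℚ.
  θ≈0⇒const : ∀ f → θ f ≈ₛ 0ₛ → f ≈ₛ const (f 0)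
  θ≈0⇒const f θf≈0 zero    = refl
  θ≈0⇒const f θf≈0 (suc n) = begin
    f (suc n)                                    ≡⟨ ℚₚ.*-identityˡ _ ⟨
    1ℚ * f (suc n)                               ≡⟨ cong (_* f (suc n)) (trans (ℚₚ.*-comm (+ 1 / suc n) _) (ι-inverse n)) ⟨
    (+ 1 / suc n) * ι (suc n) * f (suc n)        ≡⟨ ℚₚ.*-assoc (+ 1 / suc n) _ _ ⟩
    (+ 1 / suc n) * θ f (suc n)                  ≡⟨ cong ((+ 1 / suc n) *_) (θf≈0 (suc n)) ⟩
    (+ 1 / suc n) * 0ℚ                           ≡⟨ ℚₚ.*-zeroʳ (+ 1 / suc n) ⟩
    0ℚ                                           ∎
    where open ≡-Reasoning

  *ₛ-cong-≤ : ∀ f {g g′} n → (∀ m → m ≤ n → g m ≡ g′ m) → (f *ₛ g) n ≡ (f *ₛ g′) n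
  *ₛ-cong-≤ f zero    p = cong (λ b → f 0 * b + 0ℚ) (p 0 z≤n)
  *ₛ-cong-≤ f (suc n) p = cong₂ _+_ (cong (f 0 *_) (p (suc n) ℕₚ.≤-refl))
                                    (*ₛ-cong-≤ (tail f) n (λ m m≤n → p m (ℕₚ.m≤n⇒m≤1+n m≤n)))

  -- A factor without constant term raises degrees, so coefficient n of the product sees the other
  -- factor only below n. Every recursive equation for series below is handled by induction on the
  -- coefficient for this reason.
  *ₛ-cong-< : ∀ {u g g′} → u 0 ≡ 0ℚ → ∀ n → (∀ m → m < n → g m ≡ g′ m) → (u *ₛ g) n ≡ (u *ₛ g′) n
  *ₛ-cong-< {u} {g} {g′} u₀ zero    p = cong (_+ 0ℚ) (trans (0* (g 0)) (sym (0* (g′ 0))))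
    where
    0* : ∀ a → u 0 * a ≡ 0ℚ
    0* a = trans (cong (_* a) u₀) (ℚₚ.*-zeroˡ a)
  *ₛ-cong-< {u} {g} {g′} u₀ (suc n) p = cong₂ _+_ (trans (0* (g (suc n))) (sym (0* (g′ (suc n)))))
                                                  (*ₛ-cong-≤ (tail u) n (λ m m≤n → p m (s≤s m≤n)))
    where
    0* : ∀ a → u 0 * a ≡ 0ℚ
    0* a = trans (cong (_* a) u₀) (ℚₚ.*-zeroˡ a)

  *ₛ-sum : ∀ f N (c : ℕ → ℚ) (F : ℕ → Series) n →
    (f *ₛ (λ m → ∑[ k < N ] (c (toℕ k) * F (toℕ k) m))) n ≡ ∑[ k < N ] (c (toℕ k) * (f *ₛ F (toℕ k)) n)
  *ₛ-sum f zero    c F n = trans (*ₛ-comm f (λ _ → 0ℚ) n) (0-*ₛ {λ _ → 0ℚ} f (λ _ → refl) n)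
  *ₛ-sum f (suc N) c F n = begin
    (f *ₛ ((λ m → c 0 * F 0 m) +ₛ rest)) n                ≡⟨ R.distribˡ f (λ m → c 0 * F 0 m) rest n ⟩
    (f *ₛ (λ m → c 0 * F 0 m)) n + (f *ₛ rest) n
      ≡⟨ cong₂ _+_ (trans (*ₛ-comm f (λ m → c 0 * F 0 m) n) (trans (scale-*ₛ (c 0) (F 0) f n) (cong (c 0 *_) (*ₛ-comm (F 0) f n))))
                   (*ₛ-sum f N (λ k → c (suc k)) (λ k → F (suc k)) n) ⟩
    c 0 * (f *ₛ F 0) n + ∑[ k < N ] (c (suc (toℕ k)) * (f *ₛ F (suc (toℕ k))) n) ∎
    where
    open ≡-Reasoning
    rest : Series
    rest m = ∑[ k < N ] (c (suc (toℕ k)) * F (suc (toℕ k)) m)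

  -- The bound in `substitute` moves with the coefficient; this reconciles two bounds when the terms
  -- between them vanish.
  ∑-stable : ∀ (a : ℕ → ℚ) {m N} → m ≤ N → (∀ k → m ≤ k → a k ≡ 0ℚ) →
    ∑[ k < N ] (a (toℕ k)) ≡ ∑[ k < m ] (a (toℕ k))
  ∑-stable a {N = N} z≤n       a≡0 = trans (sum-cong-≗ {N} (λ k → a≡0 (toℕ k) z≤n)) (sum-replicate-zero N)
  ∑-stable a         (s≤s m≤N) a≡0 = cong (λ b → a 0 + b) (∑-stable (λ k → a (suc k)) m≤N (λ k m≤k → a≡0 (suc k) (s≤s m≤k)))

  shift : Series → Series
  shift f zero    = 0ℚ
  shift f (suc n) = f n

  derivative : Series → Series
  derivative f n = ι (suc n) * f (suc n)

  -- The Leibniz rule for f = f₀ + u t with t the tail: f′ = t + u t′.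
  derivative-tail : ∀ f → derivative f ≈ₛ tail f +ₛ shift (derivative (tail f))
  derivative-tail f zero    = trans (ℚₚ.*-identityˡ (f 1)) (sym (ℚₚ.+-identityʳ (f 1)))
  derivative-tail f (suc n) = trans (cong (_* f (suc (suc n))) (ι-suc (suc n)))
    (solve 2 (λ i a → (con 1ℚ :+ i) :* a := a :+ i :* a) refl (ι (suc n)) (f (suc (suc n))))
    where open +-*-Solver

  module _ (u : Series) (u₀ : u 0 ≡ 0ℚ) where

    ^ₛ-vanish : ∀ k n → n < k → (u ^ₛ k) n ≡ 0ℚ
    ^ₛ-vanish (suc k) n (s≤s n≤k) = trans
      (*ₛ-cong-< {u} {g′ = 0ₛ} u₀ n (λ m m<n → trans (^ₛ-vanish k m (ℕₚ.<-≤-trans m<n n≤k)) (sym (0ₛ≡0 m))))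
      (trans (R.zeroʳ u n) (0ₛ≡0 n))

    infix 9 _[u]
    _[u] : Series → Series
    f [u] = substitute f u u₀

    -- Horner's scheme. After u is factored out, the inner sum still runs over k < n, whereas the
    -- substitution at m < n stops at k = m; the surplus terms vanish because u^k starts in degree
    -- k.
    substitute-cons : ∀ f → f [u] ≈ₛ const (f 0) +ₛ u *ₛ tail f [u]
    substitute-cons f n = cong₂ _+_ (head n) (begin
      ∑[ k < n ] (f (suc (toℕ k)) * (u *ₛ u ^ₛ toℕ k) n)
        ≡⟨ *ₛ-sum u n (tail f) (u ^ₛ_) n ⟨
      (u *ₛ (λ m → ∑[ k < n ] (f (suc (toℕ k)) * (u ^ₛ toℕ k) m))) n
        ≡⟨ *ₛ-cong-< {u} u₀ n (λ m m<n → ∑-stable (λ k → f (suc k) * (u ^ₛ k) m) m<n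
             (λ k m<k → trans (cong (f (suc k) *_) (^ₛ-vanish k m m<k)) (ℚₚ.*-zeroʳ (f (suc k))))) ⟩
      (u *ₛ tail f [u]) n ∎)
      where
      open ≡-Reasoning
      head : ∀ n → f 0 * 1ₛ n ≡ const (f 0) n
      head zero    = ℚₚ.*-identityʳ (f 0)
      head (suc n) = ℚₚ.*-zeroʳ (f 0)

    substitute-cong : ∀ {f g} → f ≈ₛ g → f [u] ≈ₛ g [u]
    substitute-cong p n = sum-cong-≗ {suc n} (λ k → cong (_* (u ^ₛ toℕ k) n) (p (toℕ k)))

    substitute-+ : ∀ f g → (f +ₛ g) [u] ≈ₛ f [u] +ₛ g [u]
    substitute-+ f g n = trans
      (sum-cong-≗ {suc n} (λ k → ℚₚ.*-distribʳ-+ ((u ^ₛ toℕ k) n) (f (toℕ k)) (g (toℕ k))))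
      (∑-distrib-+ {suc n} (λ k → f (toℕ k) * (u ^ₛ toℕ k) n) (λ k → g (toℕ k) * (u ^ₛ toℕ k) n))

    substitute-scale : ∀ c f → (λ k → c * f k) [u] ≈ₛ const c *ₛ f [u]
    substitute-scale c f n = begin
      ∑[ k < suc n ] (c * f (toℕ k) * (u ^ₛ toℕ k) n)
        ≡⟨ sum-cong-≗ {suc n} (λ k → ℚₚ.*-assoc c (f (toℕ k)) ((u ^ₛ toℕ k) n)) ⟩
      ∑[ k < suc n ] (c * (f (toℕ k) * (u ^ₛ toℕ k) n))
        ≡⟨ *-distribˡ-sum {suc n} c (λ k → f (toℕ k) * (u ^ₛ toℕ k) n) ⟨
      c * (f [u]) n
        ≡⟨ const-*ₛ c (f [u]) n ⟨
      (const c *ₛ f [u]) n ∎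
      where open ≡-Reasoning

    substitute-shift : ∀ f → shift f [u] ≈ₛ u *ₛ f [u]
    substitute-shift f = R.trans (substitute-cons (shift f)) (R.+-identityˡ _)

    substitute-derivative : ∀ f → derivative f [u] ≈ₛ tail f [u] +ₛ u *ₛ derivative (tail f) [u]
    substitute-derivative f = begin
      derivative f [u]                                     ≈⟨ substitute-cong (derivative-tail f) ⟩
      (tail f +ₛ shift (derivative (tail f))) [u]          ≈⟨ substitute-+ (tail f) (shift (derivative (tail f))) ⟩
      tail f [u] +ₛ shift (derivative (tail f)) [u]        ≈⟨ R.+-congˡ {tail f [u]} (substitute-shift (derivative (tail f))) ⟩
      tail f [u] +ₛ u *ₛ derivative (tail f) [u]           ∎
      where open ≈-Reasoning

    -- By Horner's scheme θ (f(u)) = θu · t(u) + u · θ (t(u)) with t the tail of f. The factor u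
    -- makes only lower coefficients of the last term matter, so induction on the coefficient
    -- applies, with f general because it is replaced by t.
    chain-rule : ∀ f → θ (f [u]) ≈ₛ θ u *ₛ derivative f [u]
    chain-rule f n = below (suc n) n ℕₚ.≤-refl f
      where
      below : ∀ N n → n < N → ∀ f → θ (f [u]) n ≡ (θ u *ₛ derivative f [u]) n
      below (suc N) n (s≤s n≤N) f = begin
        θ (f [u]) n
          ≡⟨ θ-cong (substitute-cons f) n ⟩
        θ (const (f 0) +ₛ u *ₛ tail f [u]) n
          ≡⟨ R.trans (θ-+ (const (f 0)) (u *ₛ tail f [u]))
               (R.trans (R.+-cong (θ-const (f 0)) (θ-* u (tail f [u]))) (R.+-identityˡ _)) n ⟩
        (θ u *ₛ tail f [u]) n + (u *ₛ θ (tail f [u])) n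
          ≡⟨ cong (λ b → (θ u *ₛ tail f [u]) n + b)
               (*ₛ-cong-< {u} u₀ n (λ m m<n → below N m (ℕₚ.<-≤-trans m<n n≤N) (tail f))) ⟩
        (θ u *ₛ tail f [u]) n + (u *ₛ (θ u *ₛ derivative (tail f) [u])) n
          ≡⟨ solve 4 (λ t a b c → t :* a :+ b :* (t :* c) := t :* (a :+ b :* c)) R.refl
               (θ u) (tail f [u]) u (derivative (tail f) [u]) n ⟩
        (θ u *ₛ (tail f [u] +ₛ u *ₛ derivative (tail f) [u])) n
          ≡⟨ R.*-congˡ {θ u} (substitute-derivative f) n ⟨
        (θ u *ₛ derivative f [u]) n ∎
        where open ≡-Reasoning
              open Solver

  -- The all-ones sequence is its own tail, so Horner's scheme reads I = 1 + (1 - f) I.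
  inverseʳ : ∀ f (f₀ : f 0 ≡ 1ℚ) → f *ₛ inverse f f₀ ≈ₛ 1ₛ
  inverseʳ f f₀ = begin
    f *ₛ I                          ≈⟨ solve 2 (λ f I → f :* I := I :- (con (+ 1) :- f) :* I) R.refl f I ⟩
    I -ₛ (1ₛ -ₛ f) *ₛ I             ≈⟨ R.+-congʳ {(-ₛ ((1ₛ -ₛ f) *ₛ I))} (substitute-cons (1ₛ -ₛ f) (cong (λ c → 1ℚ - c) f₀)
                                          (λ _ → 1ℚ)) ⟩
    1ₛ +ₛ (1ₛ -ₛ f) *ₛ I -ₛ (1ₛ -ₛ f) *ₛ I
                                    ≈⟨ solve 2 (λ a b → a :+ b :- b := a) R.refl 1ₛ ((1ₛ -ₛ f) *ₛ I) ⟩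
    1ₛ ∎
    where
    open ≈-Reasoning
    open Solver
    I = inverse f f₀

  binomial-recurrence : ∀ α k → ι (suc k) * binomial α (suc k) ≡ (α - ι k) * binomial α k
  binomial-recurrence α k = begin
    ι (suc k) * (binomial α k * (α - ι k) * (+ 1 / suc k))
      ≡⟨ solve 4 (λ i b a j → i :* (b :* a :* j) := i :* j :* (a :* b)) refl
           (ι (suc k)) (binomial α k) (α - ι k) (+ 1 / suc k) ⟩
    ι (suc k) * (+ 1 / suc k) * ((α - ι k) * binomial α k)
      ≡⟨ cong (_* ((α - ι k) * binomial α k)) (ι-inverse k) ⟩
    1ℚ * ((α - ι k) * binomial α k)
      ≡⟨ ℚₚ.*-identityˡ _ ⟩
    (α - ι k) * binomial α k ∎
    where open ≡-Reasoning
          open +-*-Solver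

  -- The recurrence of the binomial coefficients says (1 + u) b′(u) = α b(u); the chain rule
  -- transports this to u = f - 1.
  power-ode : ∀ f (f₀ : f 0 ≡ 1ℚ) α → f *ₛ θ (power f f₀ α) ≈ₛ const α *ₛ θ f *ₛ power f f₀ α
  power-ode f f₀ α = begin
    f *ₛ θ P                            ≈⟨ R.*-congˡ {f} (chain-rule u u₀ b) ⟩
    f *ₛ (θ u *ₛ B)
      ≈⟨ solve 3 (λ f t B → f :* (t :* B) := t :* (B :+ (f :- con (+ 1)) :* B))
           R.refl f (θ u) B ⟩
    θ u *ₛ (B +ₛ u *ₛ B)                ≈⟨ R.*-congˡ {θ u} (R.+-congˡ {B} (substitute-shift u u₀ (derivative b))) ⟨
    θ u *ₛ (B +ₛ substitute (shift (derivative b)) u u₀)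
                                        ≈⟨ R.*-congˡ {θ u} (substitute-+ u u₀ (derivative b) (shift (derivative b))) ⟨
    θ u *ₛ substitute (derivative b +ₛ shift (derivative b)) u u₀
                                        ≈⟨ R.*-congˡ {θ u} (substitute-cong u u₀ coefficients) ⟩
    θ u *ₛ substitute (λ k → α * b k) u u₀
                                        ≈⟨ R.*-cong {θ u} {θ f} θu (substitute-scale u u₀ α b) ⟩
    θ f *ₛ (const α *ₛ P)               ≈⟨ solve 3 (λ a b c → a :* (b :* c) := b :* a :* c) R.refl (θ f) (const α) P ⟩
    const α *ₛ θ f *ₛ P                 ∎
    where
    open ≈-Reasoning
    open Solver
    u = f -ₛ 1ₛ
    u₀ : u 0 ≡ 0ℚ
    u₀ = cong (_- 1ℚ) f₀
    b = binomial α
    P = power f f₀ α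
    B = substitute (derivative b) u u₀
    θu : θ u ≈ₛ θ f
    θu = R.trans (θ-+ f (-ₛ 1ₛ)) (R.trans (R.+-congˡ {θ f} (R.trans (θ-neg 1ₛ) (R.-‿cong {θ 1ₛ} {0ₛ} (θ-const 1ℚ))))
      (solve 1 (λ a → a :- con (+ 0) := a) R.refl (θ f)))
    coefficients : derivative b +ₛ shift (derivative b) ≈ₛ (λ k → α * b k)
    coefficients zero    = trans (cong (_+ 0ℚ) (binomial-recurrence α 0))
      (Q.solve 1 (λ a → (a Q.:- Q.con 0ℚ) Q.:* Q.con 1ℚ Q.:+ Q.con 0ℚ Q.:= a Q.:* Q.con 1ℚ) refl α)
      where module Q = +-*-Solver
    coefficients (suc k) = trans (cong (_+ ι (suc k) * b (suc k)) (binomial-recurrence α (suc k)))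
      (Q.solve 3 (λ a i b → (a Q.:- i) Q.:* b Q.:+ i Q.:* b Q.:= a Q.:* b) refl α (ι (suc k)) (b (suc k)))
      where module Q = +-*-Solver

open FormalSeries

-- Transfer equations for Motzkin path statistics and their solutions

module PathSums where

  open import Data.Integer using (+_)
  open import Data.List using (List; []; _∷_; _++_; map)
  open import Data.Nat using (ℕ; zero; suc; s≤s; _≤_; _<_)
  import Data.Nat.Properties as ℕₚ
  open import Data.Rational using (ℚ; 0ℚ; 1ℚ; _+_; _*_; _-_; _/_)
  import Data.Rational.Properties as ℚₚ
  open import Data.Rational.Solver using (module +-*-Solver)
  open import Relation.Binary.PropositionalEquality using (_≡_; refl; sym; trans; cong; cong₂; module ≡-Reasoning)

  X-*ₛ : ∀ f n → (X *ₛ f) (suc n) ≡ f n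
  X-*ₛ f n = begin
    0ℚ * f (suc n) + (tail X *ₛ f) n  ≡⟨ cong₂ _+_ (ℚₚ.*-zeroˡ (f (suc n))) (*ₛ-cong {g = f} tail-X R.refl n) ⟩
    0ℚ + (1ₛ *ₛ f) n                  ≡⟨ ℚₚ.+-identityˡ _ ⟩
    (1ₛ *ₛ f) n                       ≡⟨ *ₛ-identityˡ f n ⟩
    f n                               ∎
    where
    open ≡-Reasoning
    tail-X : tail X ≈ₛ 1ₛ
    tail-X zero    = refl
    tail-X (suc n) = refl

  motzkinStep : Series → Series
  motzkinStep f = X *ₛ (1ₛ +ₛ f +ₛ f *ₛ f)

  motzkinStep-cong : ∀ f g n → (∀ m → m < n → f m ≡ g m) → motzkinStep f n ≡ motzkinStep g n
  motzkinStep-cong f g n p = *ₛ-cong-< {X} refl n λ m m<n →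
    cong₂ (λ a b → 1ₛ m + a + b) (p m m<n) (square m (λ k k≤m → p k (ℕₚ.≤-<-trans k≤m m<n)))
    where
    square : ∀ m → (∀ k → k ≤ m → f k ≡ g k) → (f *ₛ f) m ≡ (g *ₛ g) m
    square m q = trans (*ₛ-cong-≤ f m q) (trans (*ₛ-comm f g m) (*ₛ-cong-≤ g m q))

  approximation : ℕ → Series
  approximation zero    = 0ₛ
  approximation (suc i) = motzkinStep (approximation i)

  approximation-stable : ∀ {i j} n → n < i → i ≤ j → approximation i n ≡ approximation j n
  approximation-stable {suc i} {suc j} n (s≤s n≤i) (s≤s i≤j) =
    motzkinStep-cong (approximation i) (approximation j) n
      (λ m m<n → approximation-stable m (ℕₚ.<-≤-trans m<n n≤i) i≤j)

  -- The diagonal of the iterates from 0: iterate n + 1 already has the final coefficient n. The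
  -- limit is x times the generating function of Motzkin paths.
  y : Series
  y n = approximation (suc n) n

  y-fixpoint : y ≈ₛ motzkinStep y
  y-fixpoint n = motzkinStep-cong (approximation n) y n
    (λ m m<n → sym (approximation-stable m ℕₚ.≤-refl m<n))

  U : Series
  U = inverse (1ₛ -ₛ y *ₛ y) refl

  U-inverse : U *ₛ (1ₛ -ₛ y *ₛ y) ≈ₛ 1ₛ
  U-inverse n = trans (*ₛ-comm U (1ₛ -ₛ y *ₛ y) n) (inverseʳ (1ₛ -ₛ y *ₛ y) refl n)

  open MotzkinAlgebra seriesRing fromℤ-morphism using (κ; module Parametrised)

  θX : θ X ≈ₛ X
  θX zero          = refl
  θX (suc zero)    = refl
  θX (suc (suc n)) = ℚₚ.*-zeroʳ (ι (suc (suc n)))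

  κ≈ι : ∀ k → κ k ≈ₛ const (ι k)
  κ≈ι zero    n       = refl
  κ≈ι (suc k) zero    = trans (cong (λ c → 1ℚ + c) (κ≈ι k 0)) (sym (ι-suc k))
  κ≈ι (suc k) (suc n) = trans (cong (λ c → 0ℚ + c) (κ≈ι k (suc n))) (ℚₚ.+-identityˡ 0ℚ)

  -- Decomposition by the first step: X pays for the step, the neighbours are its possible ends, and
  -- S is what the starting point contributes. Height 0 has no lower neighbour.
  record Transfer (Z S : ℕ → Series) : Set where
    field
      at-zero : Z 0 ≈ₛ X *ₛ (Z 0 +ₛ Z 1) +ₛ S 0
      at-suc  : ∀ k → Z (suc k) ≈ₛ X *ₛ (Z k +ₛ Z (suc k) +ₛ Z (suc (suc k))) +ₛ S (suc k)

  -- Because of the factor X, coefficient n depends on lower coefficients at neighbouring heights;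
  -- hence induction on n for all k at once.
  transfer-unique : ∀ {Z Z′ S S′ : ℕ → Series} → Transfer Z S → Transfer Z′ S′ → (∀ k → S k ≈ₛ S′ k) → ∀ k → Z k ≈ₛ Z′ k
  transfer-unique {Z} {Z′} {S} {S′} t t′ S≈S′ k n = below (suc n) n ℕₚ.≤-refl k
    where
    open Transfer
    below : ∀ N n → n < N → ∀ k → Z k n ≡ Z′ k n
    below (suc N) n (s≤s n≤N) zero    = trans (at-zero t n) (trans
      (cong₂ _+_ (*ₛ-cong-< {X} {Z 0 +ₛ Z 1} {Z′ 0 +ₛ Z′ 1} refl n
          (λ m m<n → let ih = below N m (ℕₚ.<-≤-trans m<n n≤N) in cong₂ _+_ (ih 0) (ih 1)))
        (S≈S′ 0 n))
      (sym (at-zero t′ n)))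
    below (suc N) n (s≤s n≤N) (suc k) = trans (at-suc t k n) (trans
      (cong₂ _+_ (*ₛ-cong-< {X} {Z k +ₛ Z (suc k) +ₛ Z (suc (suc k))} {Z′ k +ₛ Z′ (suc k) +ₛ Z′ (suc (suc k))} refl n
          (λ m m<n → let ih = below N m (ℕₚ.<-≤-trans m<n n≤N) in
            cong₂ _+_ (cong₂ _+_ (ih k) (ih (suc k))) (ih (suc (suc k)))))
        (S≈S′ (suc k) n))
      (sym (at-suc t′ k n)))

  -- A path is recorded by its heights at times 0 to n - 1; the final height 0 is implicit, so
  -- length 0 is possible only from height 0.
  paths : ℕ → ℕ → List (List ℕ)
  paths zero    zero    = [] ∷ []
  paths zero    (suc k) = []
  paths (suc n) zero    = map (0 ∷_) (paths n 0 ++ paths n 1)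
  paths (suc n) (suc k) = map (suc k ∷_) ((paths n k ++ paths n (suc k)) ++ paths n (suc (suc k)))

  ∑∈ : ∀ {A : Set} → List A → (A → ℚ) → ℚ
  ∑∈ []       f = 0ℚ
  ∑∈ (p ∷ ps) f = f p + ∑∈ ps f

  module _ {A : Set} where

    ∑∈-++ : ∀ ps qs (f : A → ℚ) → ∑∈ (ps ++ qs) f ≡ ∑∈ ps f + ∑∈ qs f
    ∑∈-++ []       qs f = sym (ℚₚ.+-identityˡ _)
    ∑∈-++ (p ∷ ps) qs f = trans (cong (λ c → f p + c) (∑∈-++ ps qs f)) (sym (ℚₚ.+-assoc (f p) _ _))

    ∑∈-+ : ∀ ps (f g : A → ℚ) → ∑∈ ps (λ p → f p + g p) ≡ ∑∈ ps f + ∑∈ ps g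
    ∑∈-+ []       f g = refl
    ∑∈-+ (p ∷ ps) f g = trans (cong (λ c → f p + g p + c) (∑∈-+ ps f g))
      (solve 4 (λ a b c d → a :+ b :+ (c :+ d) := a :+ c :+ (b :+ d)) refl (f p) (g p) (∑∈ ps f) (∑∈ ps g))
      where open +-*-Solver

    ∑∈-scale : ∀ ps c (f : A → ℚ) → ∑∈ ps (λ p → c * f p) ≡ c * ∑∈ ps f
    ∑∈-scale []       c f = sym (ℚₚ.*-zeroʳ c)
    ∑∈-scale (p ∷ ps) c f = trans (cong (λ d → c * f p + d) (∑∈-scale ps c f)) (sym (ℚₚ.*-distribˡ-+ c (f p) _))

    ∑∈-map : ∀ {B : Set} (h : B → A) ps (f : A → ℚ) → ∑∈ (map h ps) f ≡ ∑∈ ps (λ p → f (h p))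
    ∑∈-map h []       f = refl
    ∑∈-map h (p ∷ ps) f = cong (λ c → f (h p) + c) (∑∈-map h ps f)

  pathSum : (List ℕ → ℚ) → ℕ → Series
  pathSum f k n = ∑∈ (paths n k) f

  -- Each suffix is weighted by its first height. Over `one` this gives an additive statistic, over
  -- another accumulation a sum over pairs c ≤ c′, which in this way also obeys a transfer equation.
  accumulate : (ℕ → ℚ) → (List ℕ → ℚ) → List ℕ → ℚ
  accumulate c h []      = 0ℚ
  accumulate c h (k ∷ p) = accumulate c h p + c k * h (k ∷ p)

  accumulate-sum : ∀ c h k ps → ∑∈ (map (k ∷_) ps) (accumulate c h) ≡ ∑∈ ps (accumulate c h) + c k * ∑∈ (map (k ∷_) ps) h
  accumulate-sum c h k ps = begin
    ∑∈ (map (k ∷_) ps) (accumulate c h)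
      ≡⟨ ∑∈-map (k ∷_) ps (accumulate c h) ⟩
    ∑∈ ps (λ p → accumulate c h p + c k * h (k ∷ p))
      ≡⟨ ∑∈-+ ps (accumulate c h) (λ p → c k * h (k ∷ p)) ⟩
    ∑∈ ps (accumulate c h) + ∑∈ ps (λ p → c k * h (k ∷ p))
      ≡⟨ cong (λ d → ∑∈ ps (accumulate c h) + d)
           (trans (∑∈-scale ps (c k) (λ p → h (k ∷ p))) (cong (c k *_) (sym (∑∈-map (k ∷_) ps h)))) ⟩
    ∑∈ ps (accumulate c h) + c k * ∑∈ (map (k ∷_) ps) h ∎
    where open ≡-Reasoning

  X-*ₛ-zero : ∀ f → (X *ₛ f) 0 ≡ 0ℚ
  X-*ₛ-zero f = trans (ℚₚ.+-identityʳ _) (ℚₚ.*-zeroˡ (f 0))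

  -- The empty path is counted by `pathSum h 0` but accumulates 0, so its source term c 0 * h [] has
  -- to vanish. This holds through c 0 = 0 or, for `cross24`, through `doubleArea []` being 0.
  transfer-accumulate : ∀ c h → c 0 * h [] ≡ 0ℚ →
    Transfer (pathSum (accumulate c h)) (λ k n → c k * pathSum h k n)
  transfer-accumulate c h c₀h≡0 = record { at-zero = at-zero ; at-suc = at-suc }
    where
    open ≡-Reasoning
    Z = pathSum (accumulate c h)
    at-zero : ∀ n → Z 0 n ≡ (X *ₛ (Z 0 +ₛ Z 1)) n + c 0 * pathSum h 0 n
    at-zero zero    = sym (cong₂ _+_ (X-*ₛ-zero (Z 0 +ₛ Z 1)) (trans (cong (c 0 *_) (ℚₚ.+-identityʳ (h []))) c₀h≡0))
    at-zero (suc n) = trans (accumulate-sum c h 0 (paths n 0 ++ paths n 1))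
      (cong (_+ c 0 * pathSum h 0 (suc n)) (trans (∑∈-++ (paths n 0) (paths n 1) (accumulate c h)) (sym (X-*ₛ (Z 0 +ₛ Z 1) n))))
    at-suc : ∀ k n → Z (suc k) n ≡ (X *ₛ (Z k +ₛ Z (suc k) +ₛ Z (suc (suc k)))) n + c (suc k) * pathSum h (suc k) n
    at-suc k zero    = sym (cong₂ _+_ (X-*ₛ-zero (Z k +ₛ Z (suc k) +ₛ Z (suc (suc k)))) (ℚₚ.*-zeroʳ (c (suc k))))
    at-suc k (suc n) = trans (accumulate-sum c h (suc k) ((paths n k ++ paths n (suc k)) ++ paths n (suc (suc k))))
      (cong (_+ c (suc k) * pathSum h (suc k) (suc n)) (begin
        ∑∈ ((paths n k ++ paths n (suc k)) ++ paths n (suc (suc k))) (accumulate c h)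
          ≡⟨ ∑∈-++ (paths n k ++ paths n (suc k)) _ (accumulate c h) ⟩
        ∑∈ (paths n k ++ paths n (suc k)) (accumulate c h) + Z (suc (suc k)) n
          ≡⟨ cong (_+ Z (suc (suc k)) n) (∑∈-++ (paths n k) _ (accumulate c h)) ⟩
        Z k n + Z (suc k) n + Z (suc (suc k)) n
          ≡⟨ X-*ₛ (Z k +ₛ Z (suc k) +ₛ Z (suc (suc k))) n ⟨
        (X *ₛ (Z k +ₛ Z (suc k) +ₛ Z (suc (suc k)))) (suc n) ∎))

  one : List ℕ → ℚ
  one _ = 1ℚ

  oneSource : ℕ → Series
  oneSource zero    = 1ₛ
  oneSource (suc _) = 0ₛ

  transfer-one : Transfer (pathSum one) oneSource
  transfer-one = record { at-zero = at-zero ; at-suc = at-suc }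
    where
    open ≡-Reasoning
    Z = pathSum one
    at-zero : ∀ n → Z 0 n ≡ (X *ₛ (Z 0 +ₛ Z 1)) n + 1ₛ n
    at-zero zero    = refl
    at-zero (suc n) = begin
      ∑∈ (map (0 ∷_) (paths n 0 ++ paths n 1)) one  ≡⟨ ∑∈-map (0 ∷_) (paths n 0 ++ paths n 1) one ⟩
      ∑∈ (paths n 0 ++ paths n 1) one               ≡⟨ ∑∈-++ (paths n 0) (paths n 1) one ⟩
      Z 0 n + Z 1 n                                 ≡⟨ X-*ₛ (Z 0 +ₛ Z 1) n ⟨
      (X *ₛ (Z 0 +ₛ Z 1)) (suc n)                   ≡⟨ ℚₚ.+-identityʳ _ ⟨
      (X *ₛ (Z 0 +ₛ Z 1)) (suc n) + 0ℚ              ∎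
    at-suc : ∀ k n → Z (suc k) n ≡ (X *ₛ (Z k +ₛ Z (suc k) +ₛ Z (suc (suc k)))) n + 0ₛ n
    at-suc k zero    = sym (trans (ℚₚ.+-identityʳ _) (X-*ₛ-zero (Z k +ₛ Z (suc k) +ₛ Z (suc (suc k)))))
    at-suc k (suc n) = begin
      ∑∈ (map (suc k ∷_) ((paths n k ++ paths n (suc k)) ++ paths n (suc (suc k)))) one
        ≡⟨ ∑∈-map (suc k ∷_) ((paths n k ++ paths n (suc k)) ++ paths n (suc (suc k))) one ⟩
      ∑∈ ((paths n k ++ paths n (suc k)) ++ paths n (suc (suc k))) one
        ≡⟨ ∑∈-++ (paths n k ++ paths n (suc k)) _ one ⟩
      ∑∈ (paths n k ++ paths n (suc k)) one + Z (suc (suc k)) n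
        ≡⟨ cong (_+ Z (suc (suc k)) n) (∑∈-++ (paths n k) _ one) ⟩
      Z k n + Z (suc k) n + Z (suc (suc k)) n
        ≡⟨ X-*ₛ (Z k +ₛ Z (suc k) +ₛ Z (suc (suc k))) n ⟨
      (X *ₛ (Z k +ₛ Z (suc k) +ₛ Z (suc (suc k)))) (suc n)
        ≡⟨ ℚₚ.+-identityʳ _ ⟨
      (X *ₛ (Z k +ₛ Z (suc k) +ₛ Z (suc (suc k)))) (suc n) + 0ℚ ∎

  -- 2 ∑ h_c, 6 ∑ C(h_c,2) and 24 ∑_{c ≤ c′} (1 - h_c) h_c′ for a path with heights h, the factors
  -- clearing the denominators of the closed forms.
  doubleArea sixBinomial cross24 : List ℕ → ℚ
  doubleArea  = accumulate (λ k → ι 2 * ι k) one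
  sixBinomial = accumulate (λ k → ι 3 * (ι k * (ι k - 1ℚ))) one
  cross24     = accumulate (λ k → ι 12 * (1ℚ - ι k)) doubleArea

  const-* : ∀ a {b f} → const b ≈ₛ f → const (a * b) ≈ₛ const a *ₛ f
  const-* a {b} {f} p n = trans (homo n) (trans (cong (a *_) (p n)) (sym (const-*ₛ a f n)))
    where
    homo : ∀ n → const (a * b) n ≡ a * const b n
    homo zero    = refl
    homo (suc n) = sym (ℚₚ.*-zeroʳ a)

  module ClosedForms (y U : Series)
    (y-fixpoint : y ≈ₛ motzkinStep y) (U-inverse : U *ₛ (1ₛ -ₛ y *ₛ y) ≈ₛ 1ₛ)
    (y₀ : y 0 ≡ 0ℚ) (U₀ : U 0 ≡ 1ℚ) where

    open import Algebra.Properties.Semiring.Exp R.semiring using (_^_)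
    open Parametrised X y U y-fixpoint U-inverse hiding (module Derivation)

    module Θ = Parametrised.Derivation X y U y-fixpoint U-inverse
      θ θ-cong θ-+ θ-neg θ-* (λ z → θ-const (z / 1)) θX

    transfer-closed : ∀ {p s : ℕ → Series} →
      (1ₛ +ₛ y *ₛ y) *ₛ p 0 ≈ₛ y *ₛ y *ₛ p 1 +ₛ M *ₛ s 0 →
      (∀ k → (1ₛ +ₛ y *ₛ y) *ₛ p (suc k) ≈ₛ p k +ₛ y *ₛ y *ₛ p (suc (suc k)) +ₛ M *ₛ s (suc k)) →
      Transfer (λ k → y ^ₛ k *ₛ p k) (λ k → y ^ₛ k *ₛ s k)
    transfer-closed {p} {s} eq₀ eq = record
      { at-zero = λ n → begin
          (1ₛ *ₛ p 0) n
            ≡⟨ *ₛ-identityˡ (p 0) n ⟩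
          p 0 n
            ≡⟨ transfer-zero (p 0) (p 1) (s 0) eq₀ n ⟩
          (X *ₛ (p 0 +ₛ y *ₛ p 1) +ₛ s 0) n
            ≡⟨ solve 5 (λ x y p q s → let I = con (+ 1) in
                 x :* (p :+ y :* q) :+ s := x :* (I :* p :+ y :* I :* q) :+ I :* s) R.refl X y (p 0) (p 1) (s 0) n ⟩
          (X *ₛ (1ₛ *ₛ p 0 +ₛ y *ₛ 1ₛ *ₛ p 1) +ₛ 1ₛ *ₛ s 0) n ∎
      ; at-suc = λ k → transfer-suc (y ^ₛ k) (p k) (p (suc k)) (p (suc (suc k))) (s (suc k)) (eq k)
      }
      where open ≡-Reasoning
            open Solver

    -- M = y / x counts the paths from 0 to 0, and each first descent to a new level contributes a
    -- factor y. The constant polynomial does not vanish at k = -1; the source of the empty path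
    -- makes up for it.
    pathSum-one : ∀ k → pathSum one k ≈ₛ y ^ₛ k *ₛ (M *ₛ 1ₛ)
    pathSum-one = transfer-unique transfer-one (transfer-closed {λ _ → M *ₛ 1ₛ} {oneSource}
        (solve 2 (λ y M → let I = con (+ 1) in
          (I :+ y :* y) :* (M :* I) := y :* y :* (M :* I) :+ M :* I) R.refl y M)
        (λ k → solve 2 (λ y M → let I = con (+ 1) in
          (I :+ y :* y) :* (M :* I) := M :* I :+ y :* y :* (M :* I) :+ M :* con (+ 0)) R.refl y M))
      source
      where
      open Solver
      source : ∀ k → oneSource k ≈ₛ y ^ₛ k *ₛ oneSource k
      source zero    = R.sym (*ₛ-identityˡ 1ₛ)
      source (suc k) = R.sym (R.zeroʳ (y ^ₛ suc k))

    -- The reduced equation contains its source as M s_k, so every accumulation contributes one more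
    -- factor M to the closed form.
    pathSum-accumulate : ∀ c h (N : Series) {γ q p : ℕ → Series} →
      (∀ k → const (c k) ≈ₛ γ k) → c 0 * h [] ≡ 0ℚ → (∀ k → pathSum h k ≈ₛ y ^ₛ k *ₛ (N *ₛ q k)) →
      (1ₛ +ₛ y *ₛ y) *ₛ p 0 ≈ₛ y *ₛ y *ₛ p 1 +ₛ γ 0 *ₛ q 0 →
      (∀ k → (1ₛ +ₛ y *ₛ y) *ₛ p (suc k) ≈ₛ p k +ₛ y *ₛ y *ₛ p (suc (suc k)) +ₛ γ (suc k) *ₛ q (suc k)) →
      ∀ k → pathSum (accumulate c h) k ≈ₛ y ^ₛ k *ₛ (M *ₛ N *ₛ p k)
    pathSum-accumulate c h N {γ} {q} {p} c≈γ c₀h≡0 closed eq₀ eq =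
      transfer-unique (transfer-accumulate c h c₀h≡0) (transfer-closed {λ k → M *ₛ N *ₛ p k} {λ k → N *ₛ (γ k *ₛ q k)}
        (λ n → begin
          ((1ₛ +ₛ y *ₛ y) *ₛ (M *ₛ N *ₛ p 0)) n
            ≡⟨ solve 4 (λ y M N p → (con (+ 1) :+ y :* y) :* (M :* N :* p) := M :* N :* ((con (+ 1) :+ y :* y) :* p))
                 R.refl y M N (p 0) n ⟩
          (M *ₛ N *ₛ ((1ₛ +ₛ y *ₛ y) *ₛ p 0)) n
            ≡⟨ R.*-congˡ {M *ₛ N} eq₀ n ⟩
          (M *ₛ N *ₛ (y *ₛ y *ₛ p 1 +ₛ γ 0 *ₛ q 0)) n
            ≡⟨ solve 5 (λ y M N p s → M :* N :* (y :* y :* p :+ s) := y :* y :* (M :* N :* p) :+ M :* (N :* s))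
                 R.refl y M N (p 1) (γ 0 *ₛ q 0) n ⟩
          (y *ₛ y *ₛ (M *ₛ N *ₛ p 1) +ₛ M *ₛ (N *ₛ (γ 0 *ₛ q 0))) n ∎)
        (λ k n → begin
          ((1ₛ +ₛ y *ₛ y) *ₛ (M *ₛ N *ₛ p (suc k))) n
            ≡⟨ solve 4 (λ y M N p → (con (+ 1) :+ y :* y) :* (M :* N :* p) := M :* N :* ((con (+ 1) :+ y :* y) :* p))
                 R.refl y M N (p (suc k)) n ⟩
          (M *ₛ N *ₛ ((1ₛ +ₛ y *ₛ y) *ₛ p (suc k))) n
            ≡⟨ R.*-congˡ {M *ₛ N} (eq k) n ⟩
          (M *ₛ N *ₛ (p k +ₛ y *ₛ y *ₛ p (suc (suc k)) +ₛ γ (suc k) *ₛ q (suc k))) n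
            ≡⟨ solve 6 (λ y M N p₀ p s → M :* N :* (p₀ :+ y :* y :* p :+ s) := M :* N :* p₀ :+ y :* y :* (M :* N :* p) :+ M :* (N :* s)) R.refl
                 y M N (p k) (p (suc (suc k))) (γ (suc k) *ₛ q (suc k)) n ⟩
          (M *ₛ N *ₛ p k +ₛ y *ₛ y *ₛ (M *ₛ N *ₛ p (suc (suc k))) +ₛ M *ₛ (N *ₛ (γ (suc k) *ₛ q (suc k)))) n ∎))
      (λ k n → begin
        c k * pathSum h k n
          ≡⟨ const-*ₛ (c k) (pathSum h k) n ⟨
        (const (c k) *ₛ pathSum h k) n
          ≡⟨ *ₛ-cong (c≈γ k) (closed k) n ⟩
        (γ k *ₛ (y ^ₛ k *ₛ (N *ₛ q k))) n
          ≡⟨ solve 4 (λ g t N q → g :* (t :* (N :* q)) := t :* (N :* (g :* q))) R.refl (γ k) (y ^ₛ k) N (q k) n ⟩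
        (y ^ₛ k *ₛ (N *ₛ (γ k *ₛ q k))) n ∎)
      where open ≡-Reasoning
            open Solver

    pathSum-doubleArea : ∀ k → pathSum doubleArea k ≈ₛ y ^ₛ k *ₛ (M *ₛ M *ₛ areaPoly (κ k))
    pathSum-doubleArea = pathSum-accumulate (λ k → ι 2 * ι k) one M
      {λ k → const (ι 2) *ₛ κ k} {λ _ → 1ₛ} {λ k → areaPoly (κ k)}
      (λ k → const-* (ι 2) (R.sym (κ≈ι k))) refl pathSum-one areaPoly-zero areaPoly-suc

    pathSum-sixBinomial : ∀ k → pathSum sixBinomial k ≈ₛ y ^ₛ k *ₛ (M *ₛ M *ₛ binomialPoly (κ k))
    pathSum-sixBinomial = pathSum-accumulate (λ k → ι 3 * (ι k * (ι k - 1ℚ))) one M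
      {λ k → const (ι 3) *ₛ (κ k *ₛ (κ k -ₛ 1ₛ))} {λ _ → 1ₛ} {λ k → binomialPoly (κ k)}
      (λ k → const-* (ι 3) (R.trans (const-* (ι k) (minus k)) (R.*-congʳ {κ k -ₛ 1ₛ} (R.sym (κ≈ι k)))))
      refl pathSum-one binomialPoly-zero binomialPoly-suc
      where
      minus : ∀ k → const (ι k - 1ℚ) ≈ₛ κ k -ₛ 1ₛ
      minus k zero    = cong (_- 1ℚ) (sym (κ≈ι k 0))
      minus k (suc n) = cong (_- 0ℚ) (sym (κ≈ι k (suc n)))

    pathSum-cross24 : ∀ k → pathSum cross24 k ≈ₛ y ^ₛ k *ₛ (M *ₛ (M *ₛ M) *ₛ crossPoly (κ k))
    pathSum-cross24 = pathSum-accumulate (λ k → ι 12 * (1ℚ - ι k)) doubleArea (M *ₛ M)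
      {λ k → const (ι 12) *ₛ (1ₛ -ₛ κ k)} {λ k → areaPoly (κ k)} {λ k → crossPoly (κ k)}
      (λ k → const-* (ι 12) (minus k)) refl pathSum-doubleArea crossPoly-zero crossPoly-suc
      where
      minus : ∀ k → const (1ℚ - ι k) ≈ₛ 1ₛ -ₛ κ k
      minus k zero    = cong (λ c → 1ℚ - c) (sym (κ≈ι k 0))
      minus k (suc n) = cong (λ c → 0ℚ - c) (sym (κ≈ι k (suc n)))

    V^-constant : ∀ n → (V ^ n) 0 ≡ 1ℚ
    V^-constant zero    = refl
    V^-constant (suc n) = cong₂ (λ a b → a * b + 0ℚ) V₀ (V^-constant n)
      where
      V₀ : V 0 ≡ 1ℚ
      V₀ = cong₂ (λ a b → (1ℚ + a + (a * a + 0ℚ)) * b + 0ℚ) y₀ U₀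

    -- P V⁵ is constant by `power-V⁵` and has constant term 1.
    inverse-power : ∀ P (P₀ : P 0 ≡ 1ℚ) α → ι 2 * α ≡ ι 5 → D *ₛ θ P ≈ₛ const α *ₛ θ D *ₛ P →
      inverse P P₀ ≈ₛ V ^ 5
    inverse-power P P₀ α 2α≡5 ode n = begin
      I n                              ≡⟨ *ₛ-identityˡ I n ⟨
      (1ₛ *ₛ I) n                      ≡⟨ R.*-congʳ {I} P*V⁵≈1 n ⟨
      (P *ₛ V ^ 5 *ₛ I) n              ≡⟨ solve 3 (λ P W I → P :* W :* I := P :* I :* W) R.refl P (V ^ 5) I n ⟩
      (P *ₛ I *ₛ V ^ 5) n              ≡⟨ R.*-congʳ {V ^ 5} (inverseʳ P P₀) n ⟩
      (1ₛ *ₛ V ^ 5) n                  ≡⟨ *ₛ-identityˡ (V ^ 5) n ⟩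
      (V ^ 5) n                        ∎
      where
      open ≡-Reasoning
      open Solver
      I : Series
      I = inverse P P₀
      2α≈5 : const (ι 2) *ₛ const α ≈ₛ const (ι 5)
      2α≈5 n = trans (const-*ₛ (ι 2) (const α) n) (value n)
        where
        value : ∀ n → ι 2 * const α n ≡ const (ι 5) n
        value zero    = 2α≡5
        value (suc n) = refl
      P*V⁵≈1 : P *ₛ V ^ 5 ≈ₛ 1ₛ
      P*V⁵≈1 n = trans (θ≈0⇒const (P *ₛ V ^ 5) (Θ.power-V⁵ P (const α) 2α≈5 ode) n)
        (cong (λ c → const c n) (cong₂ (λ a b → a * b + 0ℚ) P₀ (V^-constant 5)))

    pathSum-total : ∀ n →
      ι 4 * ((ι 2 + ι n) * pathSum sixBinomial 0 n) + pathSum cross24 0 n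
        ≡ ι 24 * divide (X ^ₛ 2) (power quadratic refl (+ 5 / 2)) refl n
    pathSum-total n = begin
      ι 4 * ((ι 2 + ι n) * pathSum sixBinomial 0 n) + pathSum cross24 0 n
        ≡⟨ cong₂ (λ a b → ι 4 * ((ι 2 + ι n) * a) + b)
             (trans (pathSum-sixBinomial 0 n) (*ₛ-identityˡ B n)) (trans (pathSum-cross24 0 n) (*ₛ-identityˡ C n)) ⟩
      ι 4 * ((ι 2 + ι n) * B n) + C n
        ≡⟨ cong (λ a → ι 4 * a + C n) (trans (ℚₚ.*-distribʳ-+ (B n) (ι 2) (ι n)) (cong (_+ ι n * B n) (sym (const-*ₛ (ι 2) B n)))) ⟩
      ι 4 * (const (ι 2) *ₛ B +ₛ θ B) n + C n
        ≡⟨ cong (_+ C n) (sym (const-*ₛ (ι 4) (const (ι 2) *ₛ B +ₛ θ B) n)) ⟩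
      (const (ι 4) *ₛ (const (ι 2) *ₛ B +ₛ θ B) +ₛ C) n
        ≡⟨ Θ.size-closed n ⟩
      (const (ι 24) *ₛ (X *ₛ X *ₛ V ^ 5)) n
        ≡⟨ const-*ₛ (ι 24) (X *ₛ X *ₛ V ^ 5) n ⟩
      ι 24 * (X *ₛ X *ₛ V ^ 5) n
        ≡⟨ cong (ι 24 *_) (*ₛ-cong square
             (inverse-power (power quadratic refl (+ 5 / 2)) refl (+ 5 / 2) refl (power-ode quadratic refl (+ 5 / 2))) n) ⟨
      ι 24 * divide (X ^ₛ 2) (power quadratic refl (+ 5 / 2)) refl n ∎
      where
      open ≡-Reasoning
      B C : Series
      B = M *ₛ M *ₛ binomialPoly (κ 0)
      C = M *ₛ (M *ₛ M) *ₛ crossPoly (κ 0)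
      square : X ^ₛ 2 ≈ₛ X *ₛ X
      square = R.*-congˡ {X} (R.*-identityʳ X)

open PathSums

-- First-column hook lengths and cores as sets closed under subtraction

module BetaSets where

  open import Data.Fin using (Fin; toℕ; fromℕ<) renaming (zero to fzero; suc to fsuc)
  open import Data.Fin.Properties using (toℕ<n; toℕ-fromℕ<)
  open import Data.List using (List; []; _∷_; length; filter)
  open import Data.List.Membership.Propositional using (_∈_; _∉_)
  open import Data.List.Properties using (filter-accept; filter-reject)
  open import Data.List.Relation.Unary.All as All using (All; []; _∷_)
  open import Data.List.Relation.Unary.AllPairs using (AllPairs; []; _∷_)
  open import Data.List.Relation.Unary.Any using (here; there)
  open import Data.List.Relation.Unary.Linked using (Linked; []; [-]; _∷_)
  open import Data.Nat hiding (_≟_)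
  open import Data.Nat.Divisibility using (_∣_; divides; ∣-refl)
  open import Data.Nat.ListAction using (sum)
  open import Data.Nat.Properties
  open import Data.Nat.Solver using (module +-*-Solver)
  open import Data.List.Membership.DecPropositional _≟_ using (_∈?_)
  open import Data.Product using (_,_; ∃)
  open import Data.Sum using (inj₁; inj₂)
  open import Function using (_∘_)
  open import Relation.Binary.Definitions using (tri<; tri≈; tri>)
  open import Relation.Binary.PropositionalEquality using (_≡_; refl; sym; trans; cong; cong₂; subst; module ≡-Reasoning)
  open import Relation.Nullary using (yes; no; contradiction)

  -- The first-column hook lengths (beta-numbers), largest first.
  β : List ℕ → List ℕ
  β []      = []
  β (a ∷ μ) = (a + length μ) ∷ β μ

  Decreasing : List ℕ → Set
  Decreasing = AllPairs _≥_

  length-β : ∀ μ → length (β μ) ≡ length μ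
  length-β []      = refl
  length-β (a ∷ μ) = cong suc (length-β μ)

  β< : ∀ {a μ x} → All (a ≥_) μ → x ∈ β μ → x < a + length μ
  β< {a} {b ∷ μ} (b≤a ∷ μ≤a) (here refl)  = +-mono-≤-< b≤a (n<1+n (length μ))
  β< {a} {b ∷ μ} (b≤a ∷ μ≤a) (there x∈)   = <-trans (β< μ≤a x∈) (+-monoʳ-< a (n<1+n (length μ)))

  large small : List ℕ → ℕ → ℕ
  large μ j = length (filter (j <?_) μ)
  small μ j = length (filter (_≤? j) μ)

  small-≤ : ∀ {a j} μ → a ≤ j → small (a ∷ μ) j ≡ suc (small μ j)
  small-≤ {j = j} μ a≤j = cong length (filter-accept (_≤? j) {xs = μ} a≤j)

  small-> : ∀ {a j} μ → j < a → small (a ∷ μ) j ≡ small μ j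
  small-> {j = j} μ j<a = cong length (filter-reject (_≤? j) {xs = μ} (<⇒≱ j<a))

  large+small : ∀ μ j → large μ j + small μ j ≡ length μ
  large+small []      j = refl
  large+small (a ∷ μ) j with <-≤-connex j a
  ... | inj₁ j<a = trans (cong₂ _+_ (cong length (filter-accept (j <?_) {xs = μ} j<a)) (small-> μ j<a))
                         (cong suc (large+small μ j))
  ... | inj₂ a≤j = trans (cong₂ _+_ (cong length (filter-reject (j <?_) {xs = μ} (≤⇒≯ a≤j))) (small-≤ μ a≤j))
                         (trans (+-suc (large μ j) (small μ j)) (cong suc (large+small μ j)))

  small-all : ∀ {μ j} → All (j ≥_) μ → small μ j ≡ length μ
  small-all         []          = refl
  small-all {a ∷ μ} (a≤j ∷ μ≤j) = trans (small-≤ μ a≤j) (cong suc (small-all μ≤j))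

  -- The gaps are the natural numbers missing from β μ, and by hook-gap the hook lengths in a row
  -- are the differences between the bead of that row and the gaps below it.
  gap : List ℕ → ℕ → ℕ
  gap μ j = j + small μ j

  gap-< : ∀ {a μ j} → All (a ≥_) μ → gap μ j < a + length μ → j < a
  gap-< {a} {μ} {j} μ≤a g< = ≰⇒> λ a≤j → <⇒≱ g< (≤-trans (+-monoˡ-≤ (length μ) a≤j)
    (≤-reflexive (cong (j +_) (sym (small-all (All.map (λ b≤a → ≤-trans b≤a a≤j) μ≤a))))))

  gap-∉ : ∀ {μ} → Decreasing μ → ∀ j → gap μ j ∉ β μ
  gap-∉ {a ∷ μ} (μ≤a ∷ d) j g∈ with <-≤-connex j a
  ... | inj₁ j<a = case (subst (λ l → j + l ∈ β (a ∷ μ)) (small-> μ j<a) g∈)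
    where
    case : gap μ j ∉ (a + length μ) ∷ β μ
    case (here eq)  = <⇒≢ (+-mono-<-≤ j<a (subst (small μ j ≤_) (large+small μ j) (m≤n+m _ _))) eq
    case (there ∈μ) = gap-∉ d j ∈μ
  ... | inj₂ a≤j = case (subst (λ l → j + l ∈ β (a ∷ μ)) (small-all (a≤j ∷ All.map (λ b≤a → ≤-trans b≤a a≤j) μ≤a)) g∈)
    where
    case : j + suc (length μ) ∉ (a + length μ) ∷ β μ
    case (here eq)  = <⇒≢ (+-mono-≤-< a≤j (n<1+n (length μ))) (sym eq)
    case (there ∈μ) = <⇒≱ (β< μ≤a ∈μ) (+-mono-≤ a≤j (n≤1+n (length μ)))

  -- Above the leading bead every part is small, so the gaps are consecutive. Below it, the gap
  -- found among the later rows keeps its column j, because `gap-<` puts j inside the first row.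
  ∉⇒gap : ∀ {μ v} → Decreasing μ → v ∉ β μ → ∃ λ j → v ≡ gap μ j
  ∉⇒gap {[]}    {v} d         v∉ = v , sym (+-identityʳ v)
  ∉⇒gap {a ∷ μ} {v} (μ≤a ∷ d) v∉ with <-cmp v (a + length μ)
  ... | tri≈ _ v≡ _ = contradiction (here v≡) v∉
  ... | tri> _ _ v> = v ∸ suc (length μ) , (begin
      v                                                        ≡⟨ m∸n+n≡m l≤v ⟨
      j + suc (length μ)                                       ≡⟨ cong (j +_) (small-all (a≤j ∷ All.map (λ b≤a → ≤-trans b≤a a≤j) μ≤a)) ⟨
      gap (a ∷ μ) j                                            ∎)
    where
    open ≡-Reasoning
    j = v ∸ suc (length μ)
    a+l≤v : a + suc (length μ) ≤ v
    a+l≤v = subst (_≤ v) (sym (+-suc a (length μ))) v>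
    l≤v : suc (length μ) ≤ v
    l≤v = ≤-trans (m≤n+m _ a) a+l≤v
    a≤j : a ≤ j
    a≤j = subst (_≤ j) (m+n∸n≡m a (suc (length μ))) (∸-monoˡ-≤ (suc (length μ)) a+l≤v)
  ... | tri< v< _ _ with ∉⇒gap d (v∉ ∘ there)
  ...   | j , refl = j , cong (j +_) (sym (small-> μ (gap-< μ≤a v<)))

  hook-gap : ∀ a μ (j : Fin a) → hook (a ∷ μ) fzero j + gap μ (toℕ j) ≡ a + length μ
  hook-gap a μ j = begin
    suc (a ∸ suc i + large μ i) + (i + small μ i)
      ≡⟨ solve 4 (λ x l i s → con 1 :+ (x :+ l) :+ (i :+ s) := x :+ (con 1 :+ i) :+ (l :+ s))
           refl (a ∸ suc i) (large μ i) i (small μ i) ⟩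
    a ∸ suc i + suc i + (large μ i + small μ i)
      ≡⟨ cong₂ _+_ (m∸n+n≡m (toℕ<n j)) (large+small μ i) ⟩
    a + length μ ∎
    where
    open ≡-Reasoning
    open +-*-Solver
    i = toℕ j

  ClosedUnder : ℕ → List ℕ → Set
  ClosedUnder t xs = ∀ v → t + v ∈ xs → v ∈ xs

  -- If the leading bead is t + v and v is a gap, then t itself is a hook length of the first row.
  core⇒closed : ∀ {t μ} → Decreasing μ → IsCore t μ → ClosedUnder t (β μ)
  core⇒closed {t}     {a ∷ μ} (μ≤a ∷ d) core v (there t+v∈) = there (core⇒closed d (λ i j → core (fsuc i) j) v t+v∈)
  core⇒closed {zero}  {a ∷ μ} (μ≤a ∷ d) core v (here v≡)    = here v≡
  core⇒closed {suc t} {a ∷ μ} (μ≤a ∷ d) core v (here t+v≡) with v ∈? β μ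
  ... | yes v∈ = there v∈
  ... | no  v∉ with ∉⇒gap d v∉
  ...   | j , refl = contradiction (subst (suc t ∣_) t≡hook ∣-refl) (core fzero (fromℕ< j<a))
    where
    j<a : j < a
    j<a = gap-< μ≤a (subst (gap μ j <_) t+v≡ (m<n+m (gap μ j) {suc t} z<s))
    t≡hook : suc t ≡ hook (a ∷ μ) fzero (fromℕ< j<a)
    t≡hook = +-cancelʳ-≡ (gap μ j) _ _ (trans t+v≡ (trans (sym (hook-gap a μ (fromℕ< j<a)))
      (cong (λ i → hook (a ∷ μ) fzero (fromℕ< j<a) + gap μ i) (toℕ-fromℕ< j<a))))

  closed-multiple : ∀ {t xs} → ClosedUnder t xs → ∀ q v → q * t + v ∈ xs → v ∈ xs
  closed-multiple         closed zero    v v∈ = v∈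
  closed-multiple {t} {xs} closed (suc q) v v∈ =
    closed-multiple closed q v (closed (q * t + v) (subst (_∈ xs) (+-assoc t (q * t) v) v∈))

  -- A hook length q t in the first row would let q subtractions of t lead from the leading bead to
  -- a gap.
  closed⇒core : ∀ {t μ} → Decreasing μ → ClosedUnder t (β μ) → IsCore t μ
  closed⇒core {t} {a ∷ μ} (μ≤a ∷ d) closed fzero j (divides q hook≡) =
    case (closed-multiple closed q g (here (trans (cong (_+ g) (sym hook≡)) (hook-gap a μ j))))
    where
    g = gap μ (toℕ j)
    case : g ∉ β (a ∷ μ)
    case (here g≡)  = <⇒≢ (subst (g <_) (hook-gap a μ j) (m<n+m g {hook (a ∷ μ) fzero j} z<s)) g≡
    case (there g∈) = gap-∉ d (toℕ j) g∈
  closed⇒core {t} {a ∷ μ} (μ≤a ∷ d) closed (fsuc i) j = closed⇒core d closed′ i j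
    where
    closed′ : ClosedUnder t (β μ)
    closed′ v t+v∈ with closed v (there t+v∈)
    ... | there v∈ = v∈
    -- v is not the leading bead, because t + v belongs to a later row and is smaller than that
    -- bead.
    ... | here v≡  = contradiction (≤-<-trans (m≤n+m v t) (β< μ≤a t+v∈)) (<-irrefl v≡)

  positive⇒0∉β : ∀ {μ} → All (_> 0) μ → 0 ∉ β μ
  positive⇒0∉β (a>0 ∷ _)  (here 0≡)  = <⇒≢ (≤-trans a>0 (m≤m+n _ _)) 0≡
  positive⇒0∉β (_ ∷ μ>0)  (there 0∈) = positive⇒0∉β μ>0 0∈

  -- The last bead equals the smallest part, so excluding the bead 0 makes every part positive.
  0∉β⇒positive : ∀ {μ} → Decreasing μ → 0 ∉ β μ → All (_> 0) μ
  0∉β⇒positive {[]}        _                 0∉ = []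
  0∉β⇒positive {a ∷ []}    _                 0∉ = n≢0⇒n>0 (λ { refl → 0∉ (here refl) }) ∷ []
  0∉β⇒positive {a ∷ b ∷ μ} ((b≤a ∷ _) ∷ d) 0∉ with 0∉β⇒positive d (0∉ ∘ there)
  ... | b>0 ∷ μ>0 = ≤-trans b>0 b≤a ∷ b>0 ∷ μ>0

  unβ : List ℕ → List ℕ
  unβ []       = []
  unβ (x ∷ xs) = (x ∸ length xs) ∷ unβ xs

  unβ-β : ∀ μ → unβ (β μ) ≡ μ
  unβ-β []      = refl
  unβ-β (a ∷ μ) = cong₂ _∷_ (trans (cong (a + length μ ∸_) (length-β μ)) (m+n∸n≡m a (length μ))) (unβ-β μ)

  StrictlyDecreasing : List ℕ → Set
  StrictlyDecreasing = AllPairs _>_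

  β-strict : ∀ {μ} → Decreasing μ → StrictlyDecreasing (β μ)
  β-strict []        = []
  β-strict (μ≤a ∷ d) = All.tabulate (β< μ≤a) ∷ β-strict d

  length-unβ : ∀ xs → length (unβ xs) ≡ length xs
  length-unβ []       = refl
  length-unβ (x ∷ xs) = cong suc (length-unβ xs)

  -- Makes the truncated subtraction in `unβ` exact.
  strict-length : ∀ {x xs} → StrictlyDecreasing (x ∷ xs) → length xs ≤ x
  strict-length {xs = []}    _                   = z≤n
  strict-length {xs = _ ∷ _} ((x>y ∷ _) ∷ d) = ≤-trans (s≤s (strict-length d)) x>y

  β-unβ : ∀ {xs} → StrictlyDecreasing xs → β (unβ xs) ≡ xs
  β-unβ []                        = refl
  β-unβ {x ∷ xs} d@(_ ∷ d′) =
    cong₂ _∷_ (trans (cong (x ∸ length xs +_) (length-unβ xs)) (m∸n+n≡m (strict-length d))) (β-unβ d′)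

  unβ-decreasing : ∀ {xs} → StrictlyDecreasing xs → Linked _≥_ (unβ xs)
  unβ-decreasing {[]}         _                       = []
  unβ-decreasing {x ∷ []}     _                       = [-]
  unβ-decreasing {x ∷ y ∷ xs} ((x>y ∷ _) ∷ d) =
    ∸-monoˡ-≤ (suc (length xs)) x>y ∷ unβ-decreasing d

  -- The row with l rows below it exceeds its part by l, and these excesses add up to ℓ (ℓ - 1) / 2
  -- for ℓ rows; the equation is cleared of halves and subtraction.
  sum-β : ∀ μ → 2 * sum μ + length μ * length μ ≡ 2 * sum (β μ) + length μ
  sum-β []      = refl
  sum-β (a ∷ μ) = begin
    2 * (a + s) + suc l * suc l
      ≡⟨ solve 3 (λ a s l → con 2 :* (a :+ s) :+ (con 1 :+ l) :* (con 1 :+ l) :=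
           con 2 :* s :+ l :* l :+ (con 2 :* a :+ con 2 :* l :+ con 1)) refl a s l ⟩
    2 * s + l * l + (2 * a + 2 * l + 1)
      ≡⟨ cong (_+ (2 * a + 2 * l + 1)) (sum-β μ) ⟩
    2 * sum (β μ) + l + (2 * a + 2 * l + 1)
      ≡⟨ solve 3 (λ a b l → con 2 :* b :+ l :+ (con 2 :* a :+ con 2 :* l :+ con 1) :=
           con 2 :* (a :+ l :+ b) :+ (con 1 :+ l)) refl a (sum (β μ)) l ⟩
    2 * (a + l + sum (β μ)) + suc l ∎
    where
    open ≡-Reasoning
    open +-*-Solver
    s = sum μ
    l = length μ

  strict-ext : ∀ {xs ys} → StrictlyDecreasing xs → StrictlyDecreasing ys →
    (∀ {v} → v ∈ xs → v ∈ ys) → (∀ {v} → v ∈ ys → v ∈ xs) → xs ≡ ys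
  strict-ext {[]}     {[]}     _ _ _ _  = refl
  strict-ext {[]}     {y ∷ ys} _ _ _ ⊇  = contradiction (⊇ (here refl)) λ ()
  strict-ext {x ∷ xs} {[]}     _ _ ⊆ _  = contradiction (⊆ (here refl)) λ ()
  strict-ext {x ∷ xs} {y ∷ ys} (x> ∷ d) (y> ∷ e) ⊆ ⊇ = cong₂ _∷_ x≡y (strict-ext d e ⊆′ ⊇′)
    where
    head-≤ : ∀ {v w ws} → All (w >_) ws → v ∈ w ∷ ws → v ≤ w
    head-≤ w> (here refl) = ≤-refl
    head-≤ w> (there v∈)  = <⇒≤ (All.lookup w> v∈)
    x≡y : x ≡ y
    x≡y = ≤-antisym (head-≤ y> (⊆ (here refl))) (head-≤ x> (⊇ (here refl)))
    ⊆′ : ∀ {v} → v ∈ xs → v ∈ ys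
    ⊆′ v∈ with ⊆ (there v∈)
    ... | there v∈ys = v∈ys
    ... | here v≡y   = contradiction (trans v≡y (sym x≡y)) (<⇒≢ (All.lookup x> v∈))
    ⊇′ : ∀ {v} → v ∈ ys → v ∈ xs
    ⊇′ v∈ with ⊇ (there v∈)
    ... | there v∈xs = v∈xs
    ... | here v≡x   = contradiction (trans v≡x x≡y) (<⇒≢ (All.lookup y> v∈))

open BetaSets

-- The bijection between triple cores and Motzkin paths on the abacus

module MotzkinPaths where

  open import Data.Empty using (⊥)
  open import Data.List using (List; []; _∷_; _++_; map; length; filter; applyUpTo; downFrom)
  open import Data.List.Membership.Propositional using (_∈_; _∉_)
  open import Data.List.Membership.Propositional.Properties
    using (∈-map⁺; ∈-map⁻; ∈-++⁺ˡ; ∈-++⁺ʳ; ∈-++⁻; ∈-filter⁺; ∈-filter⁻; ∈-downFrom⁺)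
  open import Data.List.Properties using (length-applyUpTo; ∷-injectiveʳ; map-∘; map-id-local)
  open import Data.List.Relation.Unary.All as All using ([])
  open import Data.List.Relation.Unary.AllPairs using ([]; _∷_)
  import Data.List.Relation.Unary.AllPairs.Properties as AllPairs
  open import Data.List.Relation.Unary.Any using (here; there)
  open import Data.List.Relation.Unary.Linked.Properties using (Linked⇒AllPairs)
  open import Data.List.Relation.Unary.Unique.Propositional using (Unique)
  import Data.List.Relation.Unary.Unique.Propositional.Properties as Unique
  open import Data.Nat hiding (_≟_)
  open import Data.Nat.DivMod
  open import Data.Nat.Divisibility using (divides)
  open import Data.Nat.ListAction using (sum)
  open import Data.Nat.Properties
  open import Data.Nat.Solver using (module +-*-Solver)
  open import Data.List.Membership.DecPropositional _≟_ using (_∈?_)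
  open import Data.Product using (_×_; _,_; proj₂)
  open import Data.Sum using (_⊎_; inj₁; inj₂)
  open import Function using (_∘_; flip; mk⇔)
  open import Relation.Binary.PropositionalEquality using (_≡_; refl; sym; trans; cong; cong₂; subst; module ≡-Reasoning)
  open import Relation.Nullary using (yes; no; contradiction; Dec)

  -- The default 0 beyond the end supplies the implicit final height, so `up` and `down` of `IsPath`
  -- govern the last step too.
  at : List ℕ → ℕ → ℕ
  at []      c       = 0
  at (h ∷ p) zero    = h
  at (h ∷ p) (suc c) = at p c

  at-beyond : ∀ p {c} → length p ≤ c → at p c ≡ 0
  at-beyond []      _         = refl
  at-beyond (h ∷ p) (s≤s l≤c) = at-beyond p l≤c

  at-ext : ∀ {p q} → length p ≡ length q → (∀ c → at p c ≡ at q c) → p ≡ q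
  at-ext {[]}    {[]}    _  _  = refl
  at-ext {h ∷ p} {i ∷ q} l≡ at≡ = cong₂ _∷_ (at≡ 0) (at-ext (suc-injective l≡) (at≡ ∘ suc))

  at-applyUpTo : ∀ f {n c} → c < n → at (applyUpTo f n) c ≡ f c
  at-applyUpTo f {suc n} {zero}  _         = refl
  at-applyUpTo f {suc n} {suc c} (s≤s c<n) = at-applyUpTo (f ∘ suc) c<n

  record IsPath (n k : ℕ) (p : List ℕ) : Set where
    constructor isPath
    field
      steps : length p ≡ n
      start : at p 0 ≡ k
      up    : ∀ c → at p (suc c) ≤ suc (at p c)
      down  : ∀ c → at p c ≤ suc (at p (suc c))

  open IsPath

  path-≤ : ∀ {n p} → IsPath n 0 p → ∀ c → at p c ≤ c
  path-≤ path zero    = ≤-reflexive (start path)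
  path-≤ path (suc c) = ≤-trans (up path c) (s≤s (path-≤ path c))

  cons-path : ∀ {n k l p} → l ≤ suc k → k ≤ suc l → IsPath n l p → IsPath (suc n) k (k ∷ p)
  cons-path l≤ k≤ (isPath refl refl u d) = isPath refl refl
    (λ { zero → l≤ ; (suc c) → u c }) (λ { zero → k≤ ; (suc c) → d c })

  ∈paths⇒path : ∀ n k {p} → p ∈ paths n k → IsPath n k p
  ∈paths⇒path zero    zero    (here refl) = isPath refl refl (λ _ → z≤n) (λ _ → z≤n)
  ∈paths⇒path (suc n) zero    p∈ with ∈-map⁻ (0 ∷_) p∈
  ... | q , q∈ , refl with ∈-++⁻ (paths n 0) q∈
  ...   | inj₁ q∈₀ = cons-path z≤n z≤n (∈paths⇒path n 0 q∈₀)
  ...   | inj₂ q∈₁ = cons-path ≤-refl z≤n (∈paths⇒path n 1 q∈₁)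
  ∈paths⇒path (suc n) (suc k) p∈ with ∈-map⁻ (suc k ∷_) p∈
  ... | q , q∈ , refl with ∈-++⁻ (paths n k ++ paths n (suc k)) q∈
  ...   | inj₂ q∈₂ = cons-path ≤-refl (≤-trans (n≤1+n _) (n≤1+n _)) (∈paths⇒path n (suc (suc k)) q∈₂)
  ...   | inj₁ q∈′ with ∈-++⁻ (paths n k) q∈′
  ...     | inj₁ q∈₀ = cons-path (≤-trans (n≤1+n _) (n≤1+n _)) ≤-refl (∈paths⇒path n k q∈₀)
  ...     | inj₂ q∈₁ = cons-path (n≤1+n _) (n≤1+n _) (∈paths⇒path n (suc k) q∈₁)

  path⇒∈paths : ∀ n k {p} → IsPath n k p → p ∈ paths n k
  path⇒∈paths zero    k {[]}    (isPath refl refl u d) = here refl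
  path⇒∈paths (suc n) k {h ∷ p} (isPath refl refl u d) = step h (at p 0) refl (u 0) (d 0)
    where
    tail-path : ∀ l → at p 0 ≡ l → p ∈ paths n l
    tail-path l eq = path⇒∈paths n l (isPath refl eq (u ∘ suc) (d ∘ suc))
    step : ∀ h l → at p 0 ≡ l → l ≤ suc h → h ≤ suc l → h ∷ p ∈ paths (suc n) h
    step zero    zero          eq _ _ = ∈-map⁺ (0 ∷_) (∈-++⁺ˡ (tail-path 0 eq))
    step zero    (suc zero)    eq _ _ = ∈-map⁺ (0 ∷_) (∈-++⁺ʳ (paths n 0) (tail-path 1 eq))
    step zero    (suc (suc l)) eq (s≤s ()) _
    step (suc h) l eq l≤ (s≤s h≤l) with m≤n⇒m<n∨m≡n h≤l
    ... | inj₂ refl = ∈-map⁺ (suc h ∷_) (∈-++⁺ˡ (∈-++⁺ˡ (tail-path h eq)))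
    ... | inj₁ h<l with m≤n⇒m<n∨m≡n h<l
    ...   | inj₂ refl = ∈-map⁺ (suc h ∷_) (∈-++⁺ˡ (∈-++⁺ʳ (paths n h) (tail-path (suc h) eq)))
    ...   | inj₁ h+1<l with ≤-antisym l≤ h+1<l
    ...     | refl = ∈-map⁺ (suc h ∷_) (∈-++⁺ʳ (paths n h ++ paths n (suc h)) (tail-path (suc (suc h)) eq))

  paths-unique : ∀ n k → Unique (paths n k)
  paths-unique zero    zero    = [] ∷ []
  paths-unique zero    (suc k) = []
  paths-unique (suc n) zero    = Unique.map⁺ ∷-injectiveʳ
    (Unique.++⁺ (paths-unique n 0) (paths-unique n 1) λ (p∈₀ , p∈₁) →
      contradiction (trans (sym (start (∈paths⇒path n 0 p∈₀))) (start (∈paths⇒path n 1 p∈₁))) λ ())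
  paths-unique (suc n) (suc k) = Unique.map⁺ ∷-injectiveʳ
    (Unique.++⁺ (Unique.++⁺ (paths-unique n k) (paths-unique n (suc k)) λ (p∈ , p∈′) → 1+n≢n (sym (same p∈ p∈′)))
      (paths-unique n (suc (suc k))) λ (p∈ , p∈₂) → disjoint p∈₂ (∈-++⁻ (paths n k) p∈))
    where
    same : ∀ {k l p} → p ∈ paths n k → p ∈ paths n l → k ≡ l
    same {k} {l} p∈ p∈′ = trans (sym (start (∈paths⇒path n k p∈))) (start (∈paths⇒path n l p∈′))
    disjoint : ∀ {p} → p ∈ paths n (suc (suc k)) → p ∈ paths n k ⊎ p ∈ paths n (suc k) → ⊥
    disjoint p∈₂ (inj₁ p∈₀) = <⇒≢ (≤-trans (n<1+n k) (n≤1+n (suc k))) (same p∈₀ p∈₂)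
    disjoint p∈₂ (inj₂ p∈₁) = <⇒≢ (n<1+n (suc k)) (same p∈₁ p∈₂)

  -- For a downward closed P this is the number of q < B with P q, here the number of beads on a
  -- runner.
  height : ∀ {P : ℕ → Set} → (∀ q → Dec (P q)) → ℕ → ℕ
  height P? zero    = 0
  height P? (suc B) with P? B
  ... | yes _ = suc B
  ... | no _  = height P? B

  module _ {P : ℕ → Set} (P? : ∀ q → Dec (P q)) where

    <height⇒ : (∀ {q r} → q ≤ r → P r → P q) → ∀ B {q} → q < height P? B → P q
    <height⇒ closed (suc B) q< with P? B
    ... | yes PB = closed (s≤s⁻¹ q<) PB
    ... | no _   = <height⇒ closed B q<

    ⇒<height : ∀ B {q} → q < B → P q → q < height P? B
    ⇒<height (suc B) q<B Pq with P? B
    ... | yes _ = q<B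
    ... | no ¬PB with m≤n⇒m<n∨m≡n (s≤s⁻¹ q<B)
    ...   | inj₁ q<  = ⇒<height B q< Pq
    ...   | inj₂ refl = contradiction Pq ¬PB

  ∈⇒≤sum : ∀ {v xs} → v ∈ xs → v ≤ sum xs
  ∈⇒≤sum {xs = x ∷ xs} (here refl) = m≤m+n x (sum xs)
  ∈⇒≤sum {xs = x ∷ xs} (there v∈)  = ≤-trans (∈⇒≤sum v∈) (m≤n+m (sum xs) x)

  <-ext : ∀ {a b} → (∀ {q} → q < a → q < b) → (∀ {q} → q < b → q < a) → a ≡ b
  <-ext {a} {b} f g = ≤-antisym (≮⇒≥ λ b<a → <-irrefl refl (f b<a)) (≮⇒≥ λ a<b → <-irrefl refl (g a<b))

  record TripleClosed (s : ℕ) (xs : List ℕ) : Set where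
    field
      0∉      : 0 ∉ xs
      closed₀ : ClosedUnder s xs
      closed₁ : ClosedUnder (suc s) xs
      closed₂ : ClosedUnder (suc (suc s)) xs

  open TripleClosed

  module Abacus (s : ℕ) where

    -- The middle modulus makes the other two differ from a full turn by one: subtracting s or s + 2
    -- lowers the level and moves to the next or the previous runner. Hence adjacent heights differ
    -- by at most 1.
    N : ℕ
    N = suc s

    div : ∀ {c} q → c < N → (c + q * N) / N ≡ q
    div {c} q c<N = begin
      (c + q * N) / N      ≡⟨ +-distrib-/-∣ʳ c (divides q refl) ⟩
      c / N + q * N / N    ≡⟨ cong₂ _+_ (m<n⇒m/n≡0 c<N) (m*n/n≡m q N) ⟩
      q                    ∎
      where open ≡-Reasoning

    mod : ∀ {c} q → c < N → (c + q * N) % N ≡ c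
    mod {c} q c<N = trans ([m+kn]%n≡m%n c q N) (m<n⇒m%n≡m c<N)

    -- Column c of the abacus on N runners carries at p c beads, in the positions c, c + N, c + 2 N, …
    bead? : ∀ p v → Dec (v / N < at p (v % N))
    bead? p v = v / N <? at p (v % N)

    -- For a path the bound N * N is large enough, since by `path-≤` runner c carries at most c < N
    -- beads.
    beads : List ℕ → List ℕ
    beads p = filter (bead? p) (downFrom (N * N))

    beads-strict : ∀ p → StrictlyDecreasing (beads p)
    beads-strict p = AllPairs.filter⁺ (bead? p) (AllPairs.applyDownFrom⁺₁ _ (N * N) (λ j<i _ → j<i))

    ∈beads⇒ : ∀ p {c q} → c < N → c + q * N ∈ beads p → q < at p c
    ∈beads⇒ p {c} {q} c<N v∈ = subst (_< at p c) (div q c<N)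
      (subst (λ d → (c + q * N) / N < at p d) (mod q c<N)
        (proj₂ (∈-filter⁻ (bead? p) {xs = downFrom (N * N)} v∈)))

    ⇒∈beads : ∀ {p c q} → IsPath s 0 p → c < N → q < at p c → c + q * N ∈ beads p
    ⇒∈beads {p} {c} {q} path c<N q<h = ∈-filter⁺ (bead? p) (∈-downFrom⁺ bound)
      (subst (λ d → (c + q * N) / N < at p d) (sym (mod q c<N)) (subst (_< at p c) (sym (div q c<N)) q<h))
      where
      bound : c + q * N < N * N
      bound = <-≤-trans (+-monoˡ-< (q * N) c<N) (*-monoˡ-≤ N (≤-trans q<h (≤-trans (path-≤ path c) (<⇒≤ c<N))))

    at-last : ∀ {p} → IsPath s 0 p → at p s ≡ 0
    at-last {p} path = at-beyond p (≤-reflexive (steps path))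

    byResidue : ∀ (Q : ℕ → Set) → (∀ c q → c < N → Q (c + q * N)) → ∀ v → Q v
    byResidue Q f v = subst Q (sym (m≡m%n+[m/n]*n v N)) (f (v % N) (v / N) (m%n<n v N))

    beads-closed : ∀ {p} → IsPath s 0 p → TripleClosed s (beads p)
    beads-closed {p} path = record
      { 0∉      = λ 0∈ → contradiction (∈beads⇒ p {0} {0} z<s 0∈) (≤⇒≯ (≤-reflexive (start path)))
      ; closed₀ = byResidue (λ v → s + v ∈ beads p → v ∈ beads p) down₀
      ; closed₁ = byResidue (λ v → N + v ∈ beads p → v ∈ beads p) down₁
      ; closed₂ = byResidue (λ v → suc N + v ∈ beads p → v ∈ beads p) down₂
      }
      where
      open +-*-Solver
      down₀ : ∀ c q → c < N → s + (c + q * N) ∈ beads p → c + q * N ∈ beads p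
      -- From runner 0, adding s leads to runner s, which is empty as the path ends at height 0.
      down₀ zero    q c<N v∈ = contradiction (∈beads⇒ p {s} {q} (n<1+n s) v∈) (λ q<h → n≮0 (subst (q <_) (at-last path) q<h))
      down₀ (suc c) q c<N v∈ = ⇒∈beads path c<N (s≤s⁻¹ (≤-trans
        (∈beads⇒ p {c} {suc q} (<⇒≤ c<N) (subst (_∈ beads p)
          (solve 3 (λ s c x → s :+ (con 1 :+ c :+ x) := c :+ (con 1 :+ s :+ x)) refl s c (q * N)) v∈))
        (down path c)))
      down₁ : ∀ c q → c < N → N + (c + q * N) ∈ beads p → c + q * N ∈ beads p
      down₁ c q c<N v∈ = ⇒∈beads path c<N (<⇒≤ (∈beads⇒ p {c} {suc q} c<N (subst (_∈ beads p)
        (solve 3 (λ n c x → n :+ (c :+ x) := c :+ (n :+ x)) refl N c (q * N)) v∈)))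
      down₂ : ∀ c q → c < N → suc N + (c + q * N) ∈ beads p → c + q * N ∈ beads p
      down₂ c q c<N v∈ with m≤n⇒m<n∨m≡n (s≤s⁻¹ c<N)
      ... | inj₁ c<s = ⇒∈beads path c<N (s≤s⁻¹ (≤-trans
        (∈beads⇒ p {suc c} {suc q} (s≤s c<s) (subst (_∈ beads p)
          (solve 3 (λ n c x → con 1 :+ n :+ (c :+ x) := con 1 :+ c :+ (n :+ x)) refl N c (q * N)) v∈))
        (up path c)))
      -- From runner s, adding s + 2 wraps around to runner 0 two levels higher, because s + (s + 2)
      -- = 2 N; that runner is empty.
      ... | inj₂ refl = contradiction (∈beads⇒ p {0} {suc (suc q)} z<s (subst (_∈ beads p)
          (solve 2 (λ s x → con 2 :+ s :+ (s :+ x) := con 1 :+ s :+ (con 1 :+ s :+ x)) refl s (q * N)) v∈))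
        (λ q<h → n≮0 (subst (_ <_) (start path) q<h))

    -- The search bound covers every occupied level q, as q ≤ c + q N ≤ sum xs.
    heights : List ℕ → List ℕ
    heights xs = applyUpTo (λ c → height (λ q → (c + q * N) ∈? xs) (suc (sum xs))) s

    module _ {xs : List ℕ} (closed : TripleClosed s xs) where

      column-closed : ∀ {c q r} → q ≤ r → c + r * N ∈ xs → c + q * N ∈ xs
      column-closed {c} {q} {r} q≤r v∈ = closed-multiple (closed₁ closed) (r ∸ q) (c + q * N) (subst (_∈ xs) (begin
          c + r * N                       ≡⟨ cong (λ k → c + k * N) (m∸n+n≡m q≤r) ⟨
          c + (r ∸ q + q) * N
            ≡⟨ solve 4 (λ c d q n → c :+ (d :+ q) :* n := d :* n :+ (c :+ q :* n))
                 refl c (r ∸ q) q N ⟩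
          (r ∸ q) * N + (c + q * N)       ∎) v∈)
        where open ≡-Reasoning
              open +-*-Solver

      -- Sliding down the runner would give s, and subtracting s the excluded 0. This is what brings
      -- the path back to height 0 at time s.
      last-empty : ∀ q → s + q * N ∉ xs
      last-empty q v∈ = 0∉ closed (closed₀ closed 0 (column-closed {s} {0} {q} z≤n v∈))

      <heights⇒ : ∀ {c q} → c < N → q < at (heights xs) c → c + q * N ∈ xs
      <heights⇒ {c} {q} c<N q< with m≤n⇒m<n∨m≡n (s≤s⁻¹ c<N)
      ... | inj₁ c<s = <height⇒ (λ q → (c + q * N) ∈? xs) (λ {q} {r} → column-closed {c} {q} {r}) (suc (sum xs))
        (subst (q <_) (at-applyUpTo _ c<s) q<)
      ... | inj₂ refl = contradiction (subst (q <_) (at-beyond (heights xs) (≤-reflexive (length-applyUpTo _ s))) q<) n≮0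

      ⇒<heights : ∀ {c q} → c < N → c + q * N ∈ xs → q < at (heights xs) c
      ⇒<heights {c} {q} c<N v∈ with m≤n⇒m<n∨m≡n (s≤s⁻¹ c<N)
      ... | inj₁ c<s = subst (q <_) (sym (at-applyUpTo _ c<s))
        (⇒<height (λ q → (c + q * N) ∈? xs) (suc (sum xs))
          (s≤s (≤-trans (≤-trans (m≤m*n q N) (m≤n+m (q * N) c)) (∈⇒≤sum v∈))) v∈)
      ... | inj₂ refl = contradiction v∈ (last-empty q)

      heights-beyond : ∀ {c} → s ≤ c → at (heights xs) c ≡ 0
      heights-beyond s≤c = at-beyond (heights xs) (≤-trans (≤-reflexive (length-applyUpTo _ s)) s≤c)

      heights-path : IsPath s 0 (heights xs)
      heights-path = isPath (length-applyUpTo _ s) (n≤0⇒n≡0 (≮⇒≥ (λ 0<h → 0∉ closed (<heights⇒ {0} {0} z<s 0<h)))) up′ down′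
        where
        open +-*-Solver
        ≤suc : ∀ {a b} → (∀ q → suc q < a → q < b) → a ≤ suc b
        ≤suc {zero}        f = z≤n
        ≤suc {suc zero}    f = s≤s z≤n
        ≤suc {suc (suc a)} f = s≤s (f a ≤-refl)
        up′ : ∀ c → at (heights xs) (suc c) ≤ suc (at (heights xs) c)
        up′ c with <-≤-connex (suc c) N
        ... | inj₁ c+1<N = ≤suc λ q q< → ⇒<heights (<⇒≤ c+1<N) (closed₂ closed (c + q * N) (subst (_∈ xs)
          (solve 3 (λ c n x → con 1 :+ c :+ (n :+ x) := con 1 :+ n :+ (c :+ x)) refl c N (q * N))
          (<heights⇒ {suc c} {suc q} c+1<N q<)))
        ... | inj₂ N≤c+1 = ≤-trans (≤-reflexive (heights-beyond (<⇒≤ N≤c+1))) z≤n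
        down′ : ∀ c → at (heights xs) c ≤ suc (at (heights xs) (suc c))
        down′ c with <-≤-connex c s
        ... | inj₁ c<s = ≤suc λ q q< → ⇒<heights (s≤s c<s) (closed₀ closed (suc c + q * N) (subst (_∈ xs)
          (solve 3 (λ c s x → c :+ (con 1 :+ s :+ x) := s :+ (con 1 :+ c :+ x)) refl c s (q * N))
          (<heights⇒ {c} {suc q} (m<n⇒m<1+n c<s) q<)))
        ... | inj₂ s≤c = ≤-trans (≤-reflexive (heights-beyond s≤c)) z≤n

      beads-heights : StrictlyDecreasing xs → beads (heights xs) ≡ xs
      beads-heights strict = strict-ext (beads-strict (heights xs)) strict
        (λ {v} → byResidue (λ v → v ∈ beads (heights xs) → v ∈ xs)
          (λ c q c<N v∈ → <heights⇒ {c} {q} c<N (∈beads⇒ (heights xs) c<N v∈)) v)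
        (λ {v} → byResidue (λ v → v ∈ xs → v ∈ beads (heights xs))
          (λ c q c<N v∈ → ⇒∈beads heights-path c<N (⇒<heights {c} {q} c<N v∈)) v)

    heights-beads : ∀ {p} → IsPath s 0 p → heights (beads p) ≡ p
    heights-beads {p} path = at-ext (trans (length-applyUpTo _ s) (sym (steps path))) same
      where
      same : ∀ c → at (heights (beads p)) c ≡ at p c
      same c with <-≤-connex c N
      ... | inj₁ c<N = <-ext (λ q< → ∈beads⇒ p c<N (<heights⇒ (beads-closed path) c<N q<))
                             (λ q< → ⇒<heights (beads-closed path) c<N (⇒∈beads path c<N q<))
      ... | inj₂ N≤c = trans (heights-beyond (beads-closed path) (<⇒≤ N≤c))
                             (sym (at-beyond p (≤-trans (≤-reflexive (steps path)) (<⇒≤ N≤c))))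

    toPartition : List ℕ → List ℕ
    toPartition p = unβ (beads p)

    β-toPartition : ∀ p → β (toPartition p) ≡ beads p
    β-toPartition p = β-unβ (beads-strict p)

    toPartition-core : ∀ {p} → IsPath s 0 p → IsTripleCorePartition s (toPartition p)
    toPartition-core {p} path =
      (unβ-decreasing (beads-strict p) , 0∉β⇒positive d (0∉ c)) ,
      closed⇒core d (closed₀ c) , closed⇒core d (closed₁ c) , closed⇒core d (closed₂ c)
      where
      c : TripleClosed s (β (toPartition p))
      c = subst (TripleClosed s) (sym (β-toPartition p)) (beads-closed path)
      d : Decreasing (toPartition p)
      d = Linked⇒AllPairs (flip ≤-trans) (unβ-decreasing (beads-strict p))

    core-heights : ∀ {μ} → IsTripleCorePartition s μ →
      IsPath s 0 (heights (β μ)) × toPartition (heights (β μ)) ≡ μ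
    core-heights {μ} ((linked , positive) , core₀ , core₁ , core₂) =
      heights-path closed , trans (cong unβ (beads-heights closed (β-strict d))) (unβ-β μ)
      where
      d : Decreasing μ
      d = Linked⇒AllPairs (flip ≤-trans) linked
      closed : TripleClosed s (β μ)
      closed = record
        { 0∉ = positive⇒0∉β positive
        ; closed₀ = core⇒closed d core₀ ; closed₁ = core⇒closed d core₁ ; closed₂ = core⇒closed d core₂ }

    corePartitions : List (List ℕ)
    corePartitions = map toPartition (paths s 0)

    -- `heights ∘ β` undoes `toPartition` on paths, so it maps this list back to `paths s 0`, and a
    -- repetition here would appear there.
    corePartitions-unique : Unique corePartitions
    corePartitions-unique = Unique.map⁻ {f = heights ∘ β} (subst Unique (sym (trans (sym (map-∘ (paths s 0)))
      (map-id-local (All.tabulate (λ {p} p∈ → trans (cong heights (β-toPartition p)) (heights-beads (∈paths⇒path s 0 p∈)))))))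
      (paths-unique s 0))

    coreEnumeration : CoreEnumeration s
    coreEnumeration = record
      { cores    = corePartitions
      ; unique   = corePartitions-unique
      ; complete = λ μ → mk⇔ sound complete
      }
      where
      sound : ∀ {μ} → μ ∈ corePartitions → IsTripleCorePartition s μ
      sound μ∈ with ∈-map⁻ toPartition μ∈
      ... | p , p∈ , refl = toPartition-core (∈paths⇒path s 0 p∈)
      complete : ∀ {μ} → IsTripleCorePartition s μ → μ ∈ corePartitions
      complete {μ} core = let path , eq = core-heights core in
        subst (_∈ corePartitions) eq (∈-map⁺ toPartition (path⇒∈paths s 0 path))

open MotzkinPaths

-- The size of a core in terms of the heights of its path

module PartitionSizes where

  open import Data.Bool using (true; false; if_then_else_)
  open import Data.List using (List; []; _∷_; map; length; filter; downFrom)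
  open import Data.List.Properties using (map-id)
  open import Data.Nat hiding (_≟_)
  open import Data.Nat.ListAction using (sum)
  open import Data.Nat.Properties
  open import Data.Nat.Solver using (module +-*-Solver)
  open import Data.Sum using (inj₁; inj₂)
  open import Function using (_∘_; id)
  open import Relation.Binary.PropositionalEquality using (_≡_; refl; sym; trans; cong; cong₂; module ≡-Reasoning)
  open import Relation.Nullary using (Dec; does)
  open import Relation.Nullary.Decidable using (dec-true; dec-false)

  ∑< : ℕ → (ℕ → ℕ) → ℕ
  ∑< zero    f = 0
  ∑< (suc n) f = f n + ∑< n f

  ∑<-cong : ∀ n {f g} → (∀ {i} → i < n → f i ≡ g i) → ∑< n f ≡ ∑< n g
  ∑<-cong zero    p = refl
  ∑<-cong (suc n) p = cong₂ _+_ (p ≤-refl) (∑<-cong n (p ∘ m<n⇒m<1+n))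

  ∑<-distrib-+ : ∀ n f g → ∑< n (λ i → f i + g i) ≡ ∑< n f + ∑< n g
  ∑<-distrib-+ zero    f g = refl
  ∑<-distrib-+ (suc n) f g = trans (cong (f n + g n +_) (∑<-distrib-+ n f g))
    (solve 4 (λ a b c d → a :+ b :+ (c :+ d) := a :+ c :+ (b :+ d)) refl (f n) (g n) (∑< n f) (∑< n g))
    where open +-*-Solver

  ∑<-distrib-* : ∀ n c f → ∑< n (λ i → c * f i) ≡ c * ∑< n f
  ∑<-distrib-* zero    c f = sym (*-zeroʳ c)
  ∑<-distrib-* (suc n) c f = trans (cong (c * f n +_) (∑<-distrib-* n c f)) (sym (*-distribˡ-+ c (f n) (∑< n f)))

  ∑<-zero : ∀ n → ∑< n (λ _ → 0) ≡ 0
  ∑<-zero zero    = refl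
  ∑<-zero (suc n) = ∑<-zero n

  ∑<-swap : ∀ m n (f : ℕ → ℕ → ℕ) → ∑< m (λ i → ∑< n (f i)) ≡ ∑< n (λ j → ∑< m (λ i → f i j))
  ∑<-swap zero    n f = sym (∑<-zero n)
  ∑<-swap (suc m) n f = trans (cong (∑< n (f m) +_) (∑<-swap m n f)) (sym (∑<-distrib-+ n (f m) (λ j → ∑< m (λ i → f i j))))

  ∑<-+ : ∀ m n f → ∑< (m + n) f ≡ ∑< m (λ i → f (i + n)) + ∑< n f
  ∑<-+ zero    n f = refl
  ∑<-+ (suc m) n f = trans (cong (f (m + n) +_) (∑<-+ m n f)) (sym (+-assoc (f (m + n)) _ _))

  ∑<-blocks : ∀ m n f → ∑< (m * n) f ≡ ∑< m (λ i → ∑< n (λ c → f (c + i * n)))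
  ∑<-blocks zero    n f = refl
  ∑<-blocks (suc m) n f = trans (∑<-+ n (m * n) f) (cong (∑< n (λ c → f (c + m * n)) +_) (∑<-blocks m n f))

  ∑<-suc : ∀ n f → ∑< (suc n) f ≡ f 0 + ∑< n (f ∘ suc)
  ∑<-suc zero    f = refl
  ∑<-suc (suc n) f = trans (cong (f (suc n) +_) (∑<-suc n f))
    (solve 3 (λ a b c → a :+ (b :+ c) := b :+ (a :+ c)) refl (f (suc n)) (f 0) (∑< n (f ∘ suc)))
    where open +-*-Solver

  ∑<-truncate : ∀ {h n} f → h ≤ n → ∑< n (λ q → if does (q <? h) then f q else 0) ≡ ∑< h f
  ∑<-truncate {h} {n} f h≤n with m≤n⇒m<n∨m≡n h≤n
  ... | inj₂ refl = ∑<-cong h (λ {q} q<h → cong (λ b → if b then f q else 0) (dec-true (q <? h) q<h))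
  ∑<-truncate {h} {suc n} f h≤n | inj₁ (s≤s h≤n′) =
    cong₂ _+_ (cong (λ b → if b then f n else 0) (dec-false (n <? h) (≤⇒≯ h≤n′))) (∑<-truncate f h≤n′)

  sum-filter : ∀ {P : ℕ → Set} (P? : ∀ v → Dec (P v)) (g : ℕ → ℕ) n →
    sum (map g (filter P? (downFrom n))) ≡ ∑< n (λ v → if does (P? v) then g v else 0)
  sum-filter P? g zero    = refl
  sum-filter P? g (suc n) with does (P? n)
  ... | true  = cong (g n +_) (sum-filter P? g n)
  ... | false = sum-filter P? g n

  squares : List ℕ → ℕ
  squares p = sum (map (λ h → h * h) p)

  -- This is ∑ c h_c: the height with index c lies in exactly c of the proper suffixes.
  moment : List ℕ → ℕ
  moment []      = 0
  moment (h ∷ p) = sum p + moment p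

  ∑<-at : ∀ (g : ℕ → ℕ) → g 0 ≡ 0 → ∀ {n} p → length p ≤ n → ∑< n (λ c → g (at p c)) ≡ sum (map g p)
  ∑<-at g g0 {n}     []      _         = trans (∑<-cong n (λ _ → g0)) (∑<-zero n)
  ∑<-at g g0 {suc n} (h ∷ p) (s≤s l≤n) = trans (∑<-suc n _) (cong (g h +_) (∑<-at g g0 p l≤n))

  ∑<-at-id : ∀ {n} p → length p ≤ n → ∑< n (at p) ≡ sum p
  ∑<-at-id p l≤n = trans (∑<-at id refl p l≤n) (cong sum (map-id p))

  ∑<-moment : ∀ {n} p → length p ≤ n → ∑< n (λ c → c * at p c) ≡ moment p
  ∑<-moment {n}     []      _         = trans (∑<-cong n (λ {c} _ → *-zeroʳ c)) (∑<-zero n)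
  ∑<-moment {suc n} (h ∷ p) (s≤s l≤n) = begin
    ∑< (suc n) (λ c → c * at (h ∷ p) c)              ≡⟨ ∑<-suc n _ ⟩
    ∑< n (λ c → at p c + c * at p c)                 ≡⟨ ∑<-distrib-+ n (at p) (λ c → c * at p c) ⟩
    ∑< n (at p) + ∑< n (λ c → c * at p c)            ≡⟨ cong₂ _+_ (∑<-at-id p l≤n) (∑<-moment p l≤n) ⟩
    sum p + moment p                                 ∎
    where open ≡-Reasoning

  -- Arithmetic progression: the beads of a runner sum to c h + N h (h - 1) / 2; doubled and
  -- rearranged to stay within ℕ.
  column-sum : ∀ N c h → 2 * ∑< h (λ q → c + q * N) + N * h ≡ N * (h * h) + 2 * (c * h)
  column-sum N c zero    = solve 2 (λ N c → con 0 :+ N :* con 0 := N :* con 0 :+ con 2 :* (c :* con 0)) refl N c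
    where open +-*-Solver
  column-sum N c (suc h) = begin
    2 * (c + h * N + S) + N * suc h
      ≡⟨ solve 4 (λ N c h S → con 2 :* (c :+ h :* N :+ S) :+ N :* (con 1 :+ h) :=
           con 2 :* S :+ N :* h :+ (con 2 :* c :+ con 2 :* h :* N :+ N)) refl N c h S ⟩
    2 * S + N * h + (2 * c + 2 * h * N + N)
      ≡⟨ cong (_+ (2 * c + 2 * h * N + N)) (column-sum N c h) ⟩
    N * (h * h) + 2 * (c * h) + (2 * c + 2 * h * N + N)
      ≡⟨ solve 3 (λ N c h → N :* (h :* h) :+ con 2 :* (c :* h) :+ (con 2 :* c :+ con 2 :* h :* N :+ N) :=
           N :* ((con 1 :+ h) :* (con 1 :+ h)) :+ con 2 :* (c :* (con 1 :+ h))) refl N c h ⟩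
    N * (suc h * suc h) + 2 * (c * suc h) ∎
    where
    open ≡-Reasoning
    open +-*-Solver
    S = ∑< h (λ q → c + q * N)

  length-sum : ∀ {A : Set} (xs : List A) → length xs ≡ sum (map (λ _ → 1) xs)
  length-sum []       = refl
  length-sum (x ∷ xs) = cong suc (length-sum xs)

  ∑<-one : ∀ n → ∑< n (λ _ → 1) ≡ n
  ∑<-one zero    = refl
  ∑<-one (suc n) = cong suc (∑<-one n)

  module _ (s : ℕ) where

    open Abacus s

    -- The N * N positions form a square of levels and runners. Exchanging the two sums collects
    -- each runner, whose beads fit into N levels by `path-≤`.
    sum-beads : ∀ {p} → IsPath s 0 p → ∀ g →
      sum (map g (beads p)) ≡ ∑< N (λ c → ∑< (at p c) (λ q → g (c + q * N)))
    sum-beads {p} path g = begin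
      sum (map g (beads p))
        ≡⟨ sum-filter (bead? p) g (N * N) ⟩
      ∑< (N * N) (λ v → if does (bead? p v) then g v else 0)
        ≡⟨ ∑<-blocks N N _ ⟩
      ∑< N (λ q → ∑< N (λ c → if does (bead? p (c + q * N)) then g (c + q * N) else 0))
        ≡⟨ ∑<-swap N N (λ q c → if does (bead? p (c + q * N)) then g (c + q * N) else 0) ⟩
      ∑< N (λ c → ∑< N (λ q → if does (bead? p (c + q * N)) then g (c + q * N) else 0))
        ≡⟨ ∑<-cong N (λ {c} c<N → trans
             (∑<-cong N (λ {q} _ → cong₂ (λ d r → if does (d <? at p r) then g (c + q * N) else 0) (div q c<N) (mod q c<N)))
             (∑<-truncate (λ q → g (c + q * N)) (≤-trans (path-≤ path c) (<⇒≤ c<N)))) ⟩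
      ∑< N (λ c → ∑< (at p c) (λ q → g (c + q * N))) ∎
      where open ≡-Reasoning

    module _ {p : List ℕ} (path : IsPath s 0 p) where

      private
        l≤N : length p ≤ N
        l≤N = ≤-trans (≤-reflexive (IsPath.steps path)) (n≤1+n s)

      length-toPartition : length (toPartition p) ≡ sum p
      length-toPartition = begin
        length (toPartition p)                 ≡⟨ length-unβ (beads p) ⟩
        length (beads p)                       ≡⟨ length-sum (beads p) ⟩
        sum (map (λ _ → 1) (beads p))          ≡⟨ sum-beads path (λ _ → 1) ⟩
        ∑< N (λ c → ∑< (at p c) (λ _ → 1))       ≡⟨ ∑<-cong N (λ {c} _ → ∑<-one (at p c)) ⟩
        ∑< N (at p)                              ≡⟨ ∑<-at-id p l≤N ⟩
        sum p                                    ∎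
        where open ≡-Reasoning

      sum-β-toPartition : 2 * sum (β (toPartition p)) + N * sum p ≡ N * squares p + 2 * moment p
      sum-β-toPartition = begin
        2 * sum (β (toPartition p)) + N * sum p
          ≡⟨ cong₂ (λ a b → 2 * a + N * b)
               (trans (cong sum (trans (β-toPartition p) (sym (map-id (beads p))))) (sum-beads path id))
               (sym (∑<-at-id p l≤N)) ⟩
        2 * ∑< N column + N * ∑< N (at p)
          ≡⟨ cong₂ _+_ (sym (∑<-distrib-* N 2 column)) (sym (∑<-distrib-* N N (at p))) ⟩
        ∑< N (λ c → 2 * column c) + ∑< N (λ c → N * at p c)
          ≡⟨ sym (∑<-distrib-+ N (λ c → 2 * column c) (λ c → N * at p c)) ⟩
        ∑< N (λ c → 2 * column c + N * at p c)
          ≡⟨ ∑<-cong N (λ {c} _ → column-sum N c (at p c)) ⟩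
        ∑< N (λ c → N * (at p c * at p c) + 2 * (c * at p c))
          ≡⟨ ∑<-distrib-+ N (λ c → N * (at p c * at p c)) (λ c → 2 * (c * at p c)) ⟩
        ∑< N (λ c → N * (at p c * at p c)) + ∑< N (λ c → 2 * (c * at p c))
          ≡⟨ cong₂ _+_ (∑<-distrib-* N N (λ c → at p c * at p c)) (∑<-distrib-* N 2 (λ c → c * at p c)) ⟩
        N * ∑< N (λ c → at p c * at p c) + 2 * ∑< N (λ c → c * at p c)
          ≡⟨ cong₂ (λ a b → N * a + 2 * b) (∑<-at (λ h → h * h) refl p l≤N) (∑<-moment p l≤N) ⟩
        N * squares p + 2 * moment p ∎
        where
        open ≡-Reasoning
        column : ℕ → ℕ
        column c = ∑< (at p c) (λ q → c + q * N)

      size-toPartition : 2 * sum (toPartition p) + sum p * sum p + N * sum p ≡ N * squares p + 2 * moment p + sum p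
      size-toPartition = begin
        2 * sum μ + sum p * sum p + N * sum p
          ≡⟨ cong (λ l → 2 * sum μ + l * l + N * sum p) (sym length-toPartition) ⟩
        2 * sum μ + length μ * length μ + N * sum p
          ≡⟨ cong (_+ N * sum p) (sum-β μ) ⟩
        2 * sum (β μ) + length μ + N * sum p
          ≡⟨ solve 3 (λ a b c → a :+ b :+ c := a :+ c :+ b) refl (2 * sum (β μ)) (length μ) (N * sum p) ⟩
        2 * sum (β μ) + N * sum p + length μ
          ≡⟨ cong₂ _+_ sum-β-toPartition length-toPartition ⟩
        N * squares p + 2 * moment p + sum p ∎
        where
        open ≡-Reasoning
        open +-*-Solver
        μ : List ℕ
        μ = toPartition p

open PartitionSizes

-- Total sizes as path sums, for every enumeration of the cores

module TotalSizes where

  open import Data.Integer using (+_)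
  import Data.Integer.Properties as ℤₚ
  open import Data.List using ([]; _∷_; map)
  open import Data.List.Membership.Propositional using (_∈_)
  open import Data.List.Membership.Propositional.Properties.WithK using (unique∧set⇒bag)
  open import Data.List.Relation.Binary.BagAndSetEquality using (∼bag⇒↭)
  import Data.List.Relation.Binary.Permutation.Propositional.Properties as ↭
  open import Data.List.Relation.Unary.Any using (here; there)
  import Data.Nat as ℕ
  open ℕ using (ℕ)
  open import Data.Nat.ListAction using (sum)
  open import Data.Nat.ListAction.Properties using (sum-↭)
  open import Data.Rational using (ℚ; 0ℚ; 1ℚ; _+_; _*_; _-_; _/_)
  import Data.Rational.Properties as ℚₚ
  open import Data.Rational.Solver using (module +-*-Solver)
  open import Function using (_∘_; Equivalence; mk⇔)
  open import Relation.Binary.PropositionalEquality using (_≡_; refl; sym; trans; cong; cong₂; module ≡-Reasoning)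

  ι-+ : ∀ a b → ι (a ℕ.+ b) ≡ ι a + ι b
  ι-+ a b = /1-+ (+ a) (+ b)

  ι-* : ∀ a b → ι (a ℕ.* b) ≡ ι a * ι b
  ι-* a b = trans (cong (_/ 1) (ℤₚ.pos-* a b)) (/1-* (+ a) (+ b))

  doubleArea-sum : ∀ p → doubleArea p ≡ ι 2 * ι (sum p)
  doubleArea-sum []      = refl
  doubleArea-sum (h ∷ p) = begin
    doubleArea p + ι 2 * ι h * 1ℚ        ≡⟨ cong (_+ ι 2 * ι h * 1ℚ) (doubleArea-sum p) ⟩
    ι 2 * ι (sum p) + ι 2 * ι h * 1ℚ
      ≡⟨ solve 2 (λ a h → con (ι 2) :* a :+ con (ι 2) :* h :* con 1ℚ := con (ι 2) :* (h :+ a))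
           refl (ι (sum p)) (ι h) ⟩
    ι 2 * (ι h + ι (sum p))              ≡⟨ cong (ι 2 *_) (ι-+ h (sum p)) ⟨
    ι 2 * ι (h ℕ.+ sum p)                ∎
    where open ≡-Reasoning
          open +-*-Solver

  ι-squares : ∀ h p → ι (squares (h ∷ p)) ≡ ι h * ι h + ι (squares p)
  ι-squares h p = trans (ι-+ (h ℕ.* h) (squares p)) (cong (_+ ι (squares p)) (ι-* h h))

  sixBinomial-squares : ∀ p → sixBinomial p ≡ ι 3 * (ι (squares p) - ι (sum p))
  sixBinomial-squares []      = refl
  sixBinomial-squares (h ∷ p) = begin
    sixBinomial p + ι 3 * (ι h * (ι h - 1ℚ)) * 1ℚ
      ≡⟨ cong (_+ ι 3 * (ι h * (ι h - 1ℚ)) * 1ℚ) (sixBinomial-squares p) ⟩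
    ι 3 * (ι (squares p) - ι (sum p)) + ι 3 * (ι h * (ι h - 1ℚ)) * 1ℚ
      ≡⟨ solve 3 (λ q a h → con (ι 3) :* (q :- a) :+ con (ι 3) :* (h :* (h :- con 1ℚ)) :* con 1ℚ :=
           con (ι 3) :* (h :* h :+ q :- (h :+ a))) refl (ι (squares p)) (ι (sum p)) (ι h) ⟩
    ι 3 * (ι h * ι h + ι (squares p) - (ι h + ι (sum p)))
      ≡⟨ cong₂ (λ q a → ι 3 * (q - a)) (ι-squares h p) (ι-+ h (sum p)) ⟨
    ι 3 * (ι (squares (h ∷ p)) - ι (sum (h ∷ p))) ∎
    where open ≡-Reasoning
          open +-*-Solver

  -- With a = ∑ h_c, q = ∑ h_c² and m the moment, the sum of h_c′ over c ≤ c′ is m + a, each h_c′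
  -- occurring c′ + 1 times, and the sum of h_c h_c′ is (a² + q) / 2.
  cross24-moment : ∀ p → cross24 p ≡
    ι 12 * (ι 2 * ι (moment p) + ι 2 * ι (sum p) - ι (sum p) * ι (sum p) - ι (squares p))
  cross24-moment []      = refl
  cross24-moment (h ∷ p) = begin
    cross24 p + ι 12 * (1ℚ - ι h) * doubleArea (h ∷ p)
      ≡⟨ cong₂ (λ c d → c + ι 12 * (1ℚ - ι h) * d) (cross24-moment p)
           (trans (doubleArea-sum (h ∷ p)) (cong (ι 2 *_) (ι-+ h (sum p)))) ⟩
    ι 12 * (ι 2 * m + ι 2 * a - a * a - q) + ι 12 * (1ℚ - ι h) * (ι 2 * (ι h + a))
      ≡⟨ solve 4 (λ m a q h → let two = con (ι 2) ; twelve = con (ι 12) in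
           twelve :* (two :* m :+ two :* a :- a :* a :- q) :+ twelve :* (con 1ℚ :- h) :* (two :* (h :+ a)) :=
           twelve :* (two :* (a :+ m) :+ two :* (h :+ a) :- (h :+ a) :* (h :+ a) :- (h :* h :+ q))) refl m a q (ι h) ⟩
    ι 12 * (ι 2 * (a + m) + ι 2 * (ι h + a) - (ι h + a) * (ι h + a) - (ι h * ι h + q))
      ≡⟨ cong₂ (λ m′ q′ → ι 12 * (ι 2 * m′ + ι 2 * (ι h + a) - (ι h + a) * (ι h + a) - q′)) (ι-+ (sum p) (moment p)) (ι-squares h p) ⟨
    ι 12 * (ι 2 * ι (moment (h ∷ p)) + ι 2 * (ι h + a) - (ι h + a) * (ι h + a) - ι (squares (h ∷ p)))
      ≡⟨ cong (λ a′ → ι 12 * (ι 2 * ι (moment (h ∷ p)) + ι 2 * a′ - a′ * a′ - ι (squares (h ∷ p)))) (ι-+ h (sum p)) ⟨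
    ι 12 * (ι 2 * ι (moment (h ∷ p)) + ι 2 * ι (sum (h ∷ p)) - ι (sum (h ∷ p)) * ι (sum (h ∷ p)) - ι (squares (h ∷ p))) ∎
    where
    open ≡-Reasoning
    open +-*-Solver
    m a q : ℚ
    m = ι (moment p)
    a = ι (sum p)
    q = ι (squares p)

  module _ (s : ℕ) where

    open Abacus s

    -- Twice the size is (s + 1)(q - a) + 2 m + a - a². Raising the factor to s + 2 borrows q - a,
    -- and the remainder 2 m + 2 a - a² - q is twice the cross sum: the borrowed q supplies the
    -- diagonal c = c′.
    size-statistic : ∀ {p} → IsPath s 0 p →
      ι 24 * ι (sum (toPartition p)) ≡ ι 4 * ((ι 2 + ι s) * sixBinomial p) + cross24 p
    size-statistic {p} path = begin
      ι 24 * z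
        ≡⟨ solve 3 (λ z a n → con (ι 24) :* z :=
             con (ι 12) :* (con (ι 2) :* z :+ a :* a :+ n :* a :- a :* a :- n :* a)) refl z a (1ℚ + ι s) ⟩
      ι 12 * (ι 2 * z + a * a + (1ℚ + ι s) * a - a * a - (1ℚ + ι s) * a)
        ≡⟨ cong (λ t → ι 12 * (t - a * a - (1ℚ + ι s) * a)) size ⟩
      ι 12 * ((1ℚ + ι s) * q + ι 2 * m + a - a * a - (1ℚ + ι s) * a)
        ≡⟨ solve 4 (λ q m a s →
             con (ι 12) :* ((con 1ℚ :+ s) :* q :+ con (ι 2) :* m :+ a :- a :* a :- (con 1ℚ :+ s) :* a) :=
             con (ι 4) :* ((con (ι 2) :+ s) :* (con (ι 3) :* (q :- a)))
               :+ con (ι 12) :* (con (ι 2) :* m :+ con (ι 2) :* a :- a :* a :- q)) refl q m a (ι s) ⟩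
      ι 4 * ((ι 2 + ι s) * (ι 3 * (q - a))) + ι 12 * (ι 2 * m + ι 2 * a - a * a - q)
        ≡⟨ cong₂ (λ b c → ι 4 * ((ι 2 + ι s) * b) + c) (sixBinomial-squares p) (cross24-moment p) ⟨
      ι 4 * ((ι 2 + ι s) * sixBinomial p) + cross24 p ∎
      where
      open ≡-Reasoning
      open +-*-Solver
      z m a q : ℚ
      z = ι (sum (toPartition p))
      m = ι (moment p)
      a = ι (sum p)
      q = ι (squares p)
      ι-N* : ∀ x → ι (N ℕ.* x) ≡ (1ℚ + ι s) * ι x
      ι-N* x = trans (ι-* N x) (cong (_* ι x) (ι-suc s))
      size : ι 2 * z + a * a + (1ℚ + ι s) * a ≡ (1ℚ + ι s) * q + ι 2 * m + a
      size = begin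
        ι 2 * z + a * a + (1ℚ + ι s) * a
          ≡⟨ cong₂ _+_ (cong₂ _+_ (ι-* 2 (sum (toPartition p))) (ι-* (sum p) (sum p))) (ι-N* (sum p)) ⟨
        ι (2 ℕ.* sum (toPartition p)) + ι (sum p ℕ.* sum p) + ι (N ℕ.* sum p)
          ≡⟨ trans (ι-+ (2 ℕ.* sum (toPartition p) ℕ.+ sum p ℕ.* sum p) (N ℕ.* sum p))
               (cong (_+ ι (N ℕ.* sum p)) (ι-+ (2 ℕ.* sum (toPartition p)) (sum p ℕ.* sum p))) ⟨
        ι (2 ℕ.* sum (toPartition p) ℕ.+ sum p ℕ.* sum p ℕ.+ N ℕ.* sum p)
          ≡⟨ cong ι (size-toPartition s path) ⟩
        ι (N ℕ.* squares p ℕ.+ 2 ℕ.* moment p ℕ.+ sum p)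
          ≡⟨ trans (ι-+ (N ℕ.* squares p ℕ.+ 2 ℕ.* moment p) (sum p))
               (cong (_+ a) (ι-+ (N ℕ.* squares p) (2 ℕ.* moment p))) ⟩
        ι (N ℕ.* squares p) + ι (2 ℕ.* moment p) + a
          ≡⟨ cong₂ (λ b c → b + c + a) (ι-N* (squares p)) (ι-* 2 (moment p)) ⟩
        (1ℚ + ι s) * q + ι 2 * m + a ∎

    totalSize-paths : ι 24 * ι (totalSize coreEnumeration) ≡
      ι 4 * ((ι 2 + ι s) * pathSum sixBinomial 0 s) + pathSum cross24 0 s
    totalSize-paths = go (paths s 0) (∈paths⇒path s 0)
      where
      open ≡-Reasoning
      open +-*-Solver
      go : ∀ ps → (∀ {p} → p ∈ ps → IsPath s 0 p) →
        ι 24 * ι (sum (map sum (map toPartition ps))) ≡ ι 4 * ((ι 2 + ι s) * ∑∈ ps sixBinomial) + ∑∈ ps cross24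
      go []       path = solve 1 (λ s → con (ι 24) :* con 0ℚ := con (ι 4) :* ((con (ι 2) :+ s) :* con 0ℚ) :+ con 0ℚ) refl (ι s)
      go (p ∷ ps) path = begin
        ι 24 * ι (sum (toPartition p) ℕ.+ rest)
          ≡⟨ trans (cong (ι 24 *_) (ι-+ (sum (toPartition p)) rest)) (ℚₚ.*-distribˡ-+ (ι 24) (ι (sum (toPartition p))) (ι rest)) ⟩
        ι 24 * ι (sum (toPartition p)) + ι 24 * ι rest
          ≡⟨ cong₂ _+_ (size-statistic (path (here refl))) (go ps (path ∘ there)) ⟩
        ι 4 * ((ι 2 + ι s) * sixBinomial p) + cross24 p + (ι 4 * ((ι 2 + ι s) * ∑∈ ps sixBinomial) + ∑∈ ps cross24)
          ≡⟨ solve 5 (λ t a b c d → con (ι 4) :* (t :* a) :+ b :+ (con (ι 4) :* (t :* c) :+ d) :=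
               con (ι 4) :* (t :* (a :+ c)) :+ (b :+ d)) refl (ι 2 + ι s) (sixBinomial p) (cross24 p) (∑∈ ps sixBinomial) (∑∈ ps cross24) ⟩
        ι 4 * ((ι 2 + ι s) * ∑∈ (p ∷ ps) sixBinomial) + ∑∈ (p ∷ ps) cross24 ∎
        where
        rest : ℕ
        rest = sum (map sum (map toPartition ps))

  totalSize-unique : ∀ {s} (e e′ : CoreEnumeration s) → totalSize e ≡ totalSize e′
  totalSize-unique e e′ = sum-↭ (↭.map⁺ sum (∼bag⇒↭ (unique∧set⇒bag (unique e) (unique e′)
    (λ {μ} → mk⇔ (from (complete e′ μ) ∘ to (complete e μ)) (from (complete e μ) ∘ to (complete e′ μ))))))
    where
    open CoreEnumeration
    open Equivalence

  ι24-cancel : ∀ {a b} → ι 24 * a ≡ ι 24 * b → a ≡ b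
  ι24-cancel {a} {b} eq = trans (sym (cancel a)) (trans (cong ((+ 1 / 24) *_) eq) (cancel b))
    where
    cancel : ∀ c → (+ 1 / 24) * (ι 24 * c) ≡ c
    cancel c = trans (sym (ℚₚ.*-assoc (+ 1 / 24) (ι 24) c)) (ℚₚ.*-identityˡ c)

open TotalSizes

-- The generating function of the total sizes

open import Data.Integer using (+_)
open import Data.Product using (_×_; _,_)
open import Data.Rational using (_/_)
open import Relation.Binary.PropositionalEquality using (refl; trans; cong)

theorem4p2 : (∀ s → CoreEnumeration s) ×
    ((enum : ∀ s → CoreEnumeration s) →
    generatingFunction (λ s → totalSize (enum s))
    ≈ₛ divide (X ^ₛ 2) (power quadratic refl (+ 5 / 2)) refl)
theorem4p2 = Abacus.coreEnumeration , λ enum s → trans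
  (cong ι (totalSize-unique (enum s) (Abacus.coreEnumeration s)))
  -- The two `refl` are the constant terms, 0 for `y` and 1 for `U`, which evaluate.
  (ι24-cancel (trans (totalSize-paths s) (ClosedForms.pathSum-total y U y-fixpoint U-inverse refl refl s)))
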